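{- Let $k\ge 3$ and let $F$ be a $k$-graph that does not satisfy the following condition ($\spadesuit^*$): for each pair $i<j$ in $[k]$, the edge set of $F$ can be partitioned into two spanning subhypergraphs $F^1_{i,j}$ and $F^2_{i,j}$ such that there exists an ordering of $V(F)$ which is vanishing both for $F^1_{i,j}$ and $F^2_{i,j}$, and for every pair of edges $e_1\in E(F^1_{i,j})$, $e_2\in E(F^2_{i,j})$ with $|e_1\cap e_2|=k-1$, either $e_1\cap e_2$ is $\ell$-type with respect to both $F^1_{i,j}$ and $F^2_{i,j}$ for some $\ell\in[k]$, or $e_1\cap e_2$ is $i$-type with respect to $F^1_{i,j}$ and $j$-type with respect to $F^2_{i,j}$. Then $\pi_{k-2}(F)\ge 3(k+1)^{ -k}>k^{ -k}$.
   Context: A $k$-graph is a pair $H=(V,E)$ with $E$ a set of $k$-element subsets of $V$; $H$ is $F$-free if it has no subhypergraph isomorphic to $F$. For $0\le j<k$ and a $j$-graph $G$ on $V$, $\mathcal K_k(G)$ is the set of $k$-subsets of $V$ all of whose $j$-subsets are edges of $G$. A $k$-graph $H=(V,E)$ on $n$ vertices is $(d,\mu,j)$-dense if $|\mathcal K_k(G)\cap E|\ge d|\mathcal K_k(G)|-\mu n^k$ for every $j$-graph $G$ on $V$; $\pi_j(F)$ is the supremum of all $d\in[0,1]$ such that for every $\mu>0$ and $n_0$ there is an $F$-free $(d,\mu,j)$-dense $k$-graph with at least $n_0$ vertices. The shadow of $F$ is $\partial F=\{S:|S|=k-1,\ S\subset e\text{ for some }e\in E(F)\}$. An ordering $(v_1,\dots,v_f)$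 of $V(F)$ is vanishing for $F$ if $\partial F$ can be partitioned into $k$ disjoint sets $\mathcal C_1,\dots,\mathcal C_k$ such that for every edge $e=\{v_{i(1)},\dots,v_{i(k)}\}$ with $i(1)<\dots<i(k)$, $e\setminus\{v_{i(\ell)}\}\in\mathcal C_\ell$ for all $\ell\in[k]$. Given such an ordering, a $(k-1)$-set $S$ is $\ell$-type with respect to $F$ if there is a vertex $v$ with $S\cup\{v\}\in E(F)$ such that $v$ is in the $\ell$-th position of $S\cup\{v\}$ under the ordering. A spanning subhypergraph has vertex set $V(F)$. -}

module Defs where

open import Data.Nat as ℕ using (ℕ; zero; suc; _≡ᵇ_; _<ᵇ_; _^_; _∸_; _+_)
open import Data.Nat.Properties using (m^n≢0)
open import Data.Bool using (Bool; true; false; _∧_; _∨_; not)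
open import Data.Fin using (Fin; toℕ; _≟_)
open import Data.Fin.Subset using (Subset; ∣_∣; _∈_; _∉_; _∩_; _∪_; ⁅_⁆) renaming (_-_ to _∖ₛ_)
open import Data.Vec using (Vec; []; _∷_; lookup; tabulate)
open import Data.List using (List; []; _∷_; map; _++_; [_])
open import Data.Bool.ListAction using (any)
open import Data.List.Base using (allFin)
open import Relation.Nullary.Decidable using (⌊_⌋)
open import Data.Integer using (+_)
open import Data.Rational using (ℚ; _/_; _≤_; _<_; _*_; _-_; 0ℚ)
open import Data.Product using (Σ; _×_; ∃; ∃-syntax; _,_)
open import Data.Sum using (_⊎_)
open import Function.Definitions using (Injective)
open import Relation.Binary.PropositionalEquality using (_≡_)
open import Relation.Nullary using (¬_)

IsKGraph : (k : ℕ) {n : ℕ} → (Subset n → Bool) → Set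
IsKGraph k {n} E = ∀ (S : Subset n) → E S ≡ true → ∣ S ∣ ≡ k

allSubsets : (n : ℕ) → List (Subset n)
allSubsets zero    = [ [] ]
allSubsets (suc n) = map (true ∷_) (allSubsets n) ++ map (false ∷_) (allSubsets n)

count : {n : ℕ} → (Subset n → Bool) → ℕ
count {n} p = go (allSubsets n)
  where
  go : List (Subset n) → ℕ
  go []       = 0
  go (x ∷ xs) with p x
  ... | true  = suc (go xs)
  ... | false = go xs

allᵇ : {A : Set} → (A → Bool) → List A → Bool
allᵇ p []       = true
allᵇ p (x ∷ xs) = p x ∧ allᵇ p xs

subsetᵇ : {n : ℕ} → Subset n → Subset n → Bool
subsetᵇ []       []       = true
subsetᵇ (x ∷ xs) (y ∷ ys) = (not x ∨ y) ∧ subsetᵇ xs ys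

inK : {n : ℕ} (k j : ℕ) (G : Subset n → Bool) → Subset n → Bool
inK {n} k j G S =
  (∣ S ∣ ≡ᵇ k) ∧ allᵇ (λ T → not (subsetᵇ T S ∧ (∣ T ∣ ≡ᵇ j)) ∨ G T) (allSubsets n)

ℕ→ℚ : ℕ → ℚ
ℕ→ℚ m = (+ m) / 1

Dense : (k : ℕ) {n : ℕ} (E : Subset n → Bool) (d μ : ℚ) (j : ℕ) → Set
Dense k {n} E d μ j =
  ∀ (G : Subset n → Bool) →
    d * ℕ→ℚ (count (inK k j G)) - μ * ℕ→ℚ (n ^ k)
      ≤ ℕ→ℚ (count (λ S → inK k j G S ∧ E S))

image : {f n : ℕ} → (Fin f → Fin n) → Subset f → Subset n
image {f} φ S = tabulate (λ y → any (λ x → lookup S x ∧ ⌊ φ x ≟ y ⌋) (allFin f))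

Contains : {f n : ℕ} (EF : Subset f → Bool) (E : Subset n → Bool) → Set
Contains {f} {n} EF E =
  ∃[ φ ] (Injective {A = Fin f} {B = Fin n} _≡_ _≡_ φ ×
          (∀ (e : Subset f) → EF e ≡ true → E (image φ e) ≡ true))

FFree : {f n : ℕ} (EF : Subset f → Bool) (E : Subset n → Bool) → Set
FFree EF E = ¬ Contains EF E

-- Orderings.  An ordering (v_1,…,v_f) of Fin f is given by the injective
-- map rk : Fin f → Fin f sending a vertex to its (0-based) position.

rankIn : {f : ℕ} → (Fin f → Fin f) → Subset f → Fin f → ℕ
rankIn {f} rk e v = go (allFin f)
  where
  go : List (Fin f) → ℕ
  go []       = 0
  go (u ∷ us) with lookup e u ∧ (toℕ (rk u) <ᵇ toℕ (rk v))
  ... | true  = suc (go us)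
  ... | false = go us

-- The ordering rk is vanishing for the k-graph (Fin f, E'): the shadow is
-- partitioned into classes C_0,…,C_{k-1} (colouring c; values of c off the
-- shadow are irrelevant) so that for every edge e and v ∈ e at (0-based)
-- position ℓ of e, e ∖ {v} ∈ C_ℓ.
Vanishing : (k : ℕ) {f : ℕ} → (Fin f → Fin f) → (Subset f → Bool) → Set
Vanishing k {f} rk E' =
  Σ (Subset f → Fin k) λ c → (∀ (e : Subset f) → E' e ≡ true → ∀ (v : Fin f) → v ∈ e →
            toℕ (c (e ∖ₛ v)) ≡ rankIn rk e v)

LType : {f : ℕ} → (Fin f → Fin f) → (Subset f → Bool) → Subset f → ℕ → Set
LType rk E' S ℓ =
  Σ (Fin _) λ v → (v ∉ S × E' (S ∪ ⁅ v ⁆) ≡ true × rankIn rk (S ∪ ⁅ v ⁆) v ≡ ℓ)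

-- Condition (♠*) for the k-graph F = (Fin f, EF).  Indices i, j, ℓ ∈ [k]
-- are represented 0-based by Fin k.  The partition of E(F) into the two
-- spanning subhypergraphs is given by σ (σ e = true ↦ F¹, false ↦ F²).
-- the two parts of the edge set of F selected by σ
part₁ part₂ : {f : ℕ} → (Subset f → Bool) → (Subset f → Bool) → Subset f → Bool
part₁ EF σ e = EF e ∧ σ e
part₂ EF σ e = EF e ∧ not (σ e)

SpadeClause : (k : ℕ) {f : ℕ} (i j : Fin k) → (Fin f → Fin f) →
              (E₁ E₂ : Subset f → Bool) → Set
SpadeClause k {f} i j rk E₁ E₂ =
  Injective _≡_ _≡_ rk ×
  Vanishing k rk E₁ × Vanishing k rk E₂ ×
  (∀ (e₁ e₂ : Subset f) → E₁ e₁ ≡ true → E₂ e₂ ≡ true →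
     ∣ e₁ ∩ e₂ ∣ ≡ k ∸ 1 →
     (Σ (Fin k) λ ℓ → (LType rk E₁ (e₁ ∩ e₂) (toℕ ℓ) × LType rk E₂ (e₁ ∩ e₂) (toℕ ℓ)))
     ⊎ (LType rk E₁ (e₁ ∩ e₂) (toℕ i) × LType rk E₂ (e₁ ∩ e₂) (toℕ j)))

Spade : (k : ℕ) {f : ℕ} → (Subset f → Bool) → Set
Spade k {f} EF =
  ∀ (i j : Fin k) → toℕ i ℕ.< toℕ j →
  Σ (Subset f → Bool) λ σ → Σ (Fin f → Fin f) λ rk →
    SpadeClause k i j rk (part₁ EF σ) (part₂ EF σ)

-- d belongs to the set whose supremum is π_j(F): for every μ > 0 and n₀
-- there is an F-free (d, μ, j)-dense k-graph on n ≥ n₀ vertices.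
Admissible : (k j : ℕ) {f : ℕ} (EF : Subset f → Bool) (d : ℚ) → Set
Admissible k j EF d =
  ∀ (μ : ℚ) → 0ℚ < μ → ∀ (n₀ : ℕ) →
    ∃[ n ] (n₀ ℕ.≤ n × Σ (Subset n → Bool) λ E → (IsKGraph k {n} E × FFree EF E × Dense k E d μ j))

-- π_j(F) ≥ c.  Since the admissible set is downward closed in [0,1]
-- (density conditions are monotone in d and in μ), sup ≥ c is equivalent
-- to: every d ∈ [0, c) is admissible; rational d and μ suffice by density
-- of ℚ and monotonicity.
PiAtLeast : (k j : ℕ) {f : ℕ} (EF : Subset f → Bool) (c : ℚ) → Set
PiAtLeast k j EF c = ∀ (d : ℚ) → 0ℚ ≤ d → d < c → Admissible k j EF d

threeOver : ℕ → ℚ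
threeOver k = _/_ (+ 3) (suc k ^ k) {{m^n≢0 (suc k) k}}

-- k^{-k}  (value at k = 0 is a junk 0, never used since k ≥ 3)
invPow : ℕ → ℚ
invPow zero    = 0ℚ
invPow (suc m) = _/_ (+ 1) (suc m ^ suc m) {{m^n≢0 (suc m) (suc m)}}

{-# OPTIONS --safe #-}
module Submission where

-- Colour the (k-1)-sets of an ordered vertex set with k + 1 colours.  Given positions i < j,
-- let a k-set be an edge if its face without the ℓ-th vertex has colour ℓ for every ℓ ≠ i, j,
-- while the colours at positions (i , j) are (x , y), (z , x) or (z , y), for three further
-- colours x, y, z.  If F embeds into this graph, then the edges of type (x , y) and the
-- others, with the order induced by the embedding, witness (♠*) for (i , j).
--
-- The density is reached by a colouring such that, for each vertex v, pattern and (k-2)-graph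
-- G, the (k-1)-sets that complete with v to a clique of G whose faces below v fit the pattern
-- have the next colour of the pattern about once in k + 1 times.  Only labels of (k-2)-sets
-- enter into such a test, so there are 2^O(n^(k-2)) tests on n^(k-1) independent colours, and
-- a Chernoff bound, derandomised by a potential function, yields the colouring.

open import Defs
open import Data.Nat using (ℕ; zero; suc; _+_; _*_; _^_; _∸_; _≤_; _<_; z≤n; s≤s; _≡ᵇ_; _<ᵇ_; _≤?_; _<?_; NonZero; >-nonZero; >-nonZero⁻¹)
open import Data.Nat.Properties
open import Data.Nat.Tactic.RingSolver using (solve-∀)
import Data.Integer as ℤ
import Data.Integer.Properties as ℤ
open import Data.Rational as ℚ using (ℚ; mkℚ; 0ℚ; _/_; toℚᵘ)
import Data.Rational.Properties as ℚ
open import Data.Rational.Unnormalised as ℚᵘ using (mkℚᵘ; *≤*; *<*)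
import Data.Rational.Unnormalised.Properties as ℚᵘ
open import Data.Bool using (Bool; true; false; _∧_; _∨_; not; if_then_else_)
open import Data.Bool.Properties using (T-≡; ∧-assoc; not-injective) renaming (_≟_ to _≟ᵇ_)
open import Data.Bool.ListAction using (any)
open import Data.Fin using (Fin; toℕ; fromℕ<; #_) renaming (zero to fzero; suc to fsuc; _≟_ to _≟ᶠ_)
open import Data.Fin.Properties using (toℕ<n; toℕ-fromℕ<; toℕ-injective; any?; all?)
open import Data.Fin.Subset using (Subset; ∣_∣; _∩_; _∪_; ⁅_⁆) renaming (_-_ to _∖ₛ_; _∉_ to _∉ˢ_)
open import Data.Fin.Subset.Properties using (∩-comm; ∪-identityʳ; p─⊥≡p)
open import Data.Vec using (Vec; []; _∷_; lookup; tabulate; _[_]≔_)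
open import Data.Vec.Properties using (≡-dec; lookup∘tabulate; tabulate∘lookup; tabulate-cong; []=⇒lookup; lookup∘updateAt; lookup∘updateAt′; updateAt-updateAt; updateAt-id-local)
open import Data.List using (List; []; _∷_; map; _++_; length; allFin; cartesianProduct; cartesianProductWith; filterᵇ)
open import Data.List.Properties using (map-tabulate; length-tabulate; length-++; length-map)
open import Data.List.Membership.Propositional using (_∈_)
open import Data.List.Membership.Propositional.Properties using (∈-cartesianProduct⁺; ∈-cartesianProductWith⁺; ∈-allFin; ∈-map⁺; ∈-map⁻; ∈-++⁺ˡ; ∈-++⁺ʳ)
open import Data.List.Relation.Unary.Any using (here; there)
open import Data.List.Relation.Unary.All as All using (All; []; _∷_)
open import Data.List.Relation.Unary.Unique.Propositional using (Unique; []; _∷_)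
open import Data.List.Relation.Unary.Unique.Propositional.Properties using (map⁺; ++⁺)
open import Data.Product using (∃; Σ; _,_; _×_; proj₁; proj₂)
open import Data.Sum as Sum using (_⊎_; inj₁; inj₂)
open import Data.Empty using (⊥; ⊥-elim)
open import Function using (_∘_; id; const; Equivalence)
open import Function.Definitions using (Injective)
open import Relation.Nullary using (Dec; yes; no; does; ¬_; contradiction)
open import Relation.Nullary.Decidable using (⌊_⌋; isYes≗does; dec-true; dec-false; map′; _×-dec_; _→-dec_)
open import Relation.Binary.Definitions using (DecidableEquality; tri<; tri≈; tri>)
open import Relation.Binary.PropositionalEquality

-- A face of colour `x` belongs at position `i` in edges of type `(x , y)` and at position `j` in
-- all others; `y` always belongs at `j`, `z` only at `i` in the other types, and the remaining
-- colours at their own positions. So within each part the colour of a face determines the position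
-- of the missing vertex, and a face shared by the two parts can disagree only as `i` against `j`,
-- the one disagreement that (♠*) permits. The obstacle to density is that `G` is arbitrary and may
-- depend on the colouring, and that the sets tested at one position depend on colours met at
-- earlier positions. Fixing the vertex `v` at the current position resolves both: the earlier faces
-- contain `v`, the face under test does not. The earlier colours can thus be guessed before
-- anything is coloured, and a union bound over all guesses is affordable, since a linear deviation
-- among n^(k-1) colours is exponentially unlikely in n^(k-1). Only a shortage of the wanted colour
-- is harmful, so a one-sided potential with natural-number weights suffices.

private variable
  A B : Set

-- Finite sums, and counting as summation

⟦_⟧ : Bool → ℕ
⟦ true ⟧  = 1
⟦ false ⟧ = 0

∑ : List A → (A → ℕ) → ℕ
∑ []       g = 0
∑ (x ∷ xs) g = g x + ∑ xs g

∑-cong : (xs : List A) {g h : A → ℕ} → (∀ x → g x ≡ h x) → ∑ xs g ≡ ∑ xs h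
∑-cong []       g≗h = refl
∑-cong (x ∷ xs) g≗h = cong₂ _+_ (g≗h x) (∑-cong xs g≗h)

∑-mono : (xs : List A) {g h : A → ℕ} → (∀ x → g x ≤ h x) → ∑ xs g ≤ ∑ xs h
∑-mono []       g≤h = z≤n
∑-mono (x ∷ xs) g≤h = +-mono-≤ (g≤h x) (∑-mono xs g≤h)

interchange-+ : ∀ a b c d → (a + b) + (c + d) ≡ (a + c) + (b + d)
interchange-+ = solve-∀

∑-+ : (xs : List A) (g h : A → ℕ) → ∑ xs (λ x → g x + h x) ≡ ∑ xs g + ∑ xs h
∑-+ []       g h = refl
∑-+ (x ∷ xs) g h = trans (cong (g x + h x +_) (∑-+ xs g h)) (interchange-+ (g x) (h x) _ _)

∑-*ˡ : (c : ℕ) (xs : List A) (g : A → ℕ) → ∑ xs (λ x → c * g x) ≡ c * ∑ xs g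
∑-*ˡ c []       g = sym (*-zeroʳ c)
∑-*ˡ c (x ∷ xs) g = trans (cong (c * g x +_) (∑-*ˡ c xs g)) (sym (*-distribˡ-+ c (g x) (∑ xs g)))

∑-const : (c : ℕ) (xs : List A) → ∑ xs (λ _ → c) ≡ length xs * c
∑-const c []       = refl
∑-const c (x ∷ xs) = cong (c +_) (∑-const c xs)

∑-swap : (xs : List A) (ys : List B) (g : A → B → ℕ) →
  ∑ xs (λ x → ∑ ys (g x)) ≡ ∑ ys (λ y → ∑ xs (λ x → g x y))
∑-swap []       ys g = sym (trans (∑-const 0 ys) (*-zeroʳ (length ys)))
∑-swap (x ∷ xs) ys g =
  trans (cong (∑ ys (g x) +_) (∑-swap xs ys g)) (sym (∑-+ ys (g x) (λ y → ∑ xs (λ x → g x y))))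

∑-++ : (xs ys : List A) (g : A → ℕ) → ∑ (xs ++ ys) g ≡ ∑ xs g + ∑ ys g
∑-++ []       ys g = refl
∑-++ (x ∷ xs) ys g = trans (cong (g x +_) (∑-++ xs ys g)) (sym (+-assoc (g x) (∑ xs g) (∑ ys g)))

∑-map : (h : A → B) (xs : List A) (g : B → ℕ) → ∑ (map h xs) g ≡ ∑ xs (g ∘ h)
∑-map h []       g = refl
∑-map h (x ∷ xs) g = cong (g (h x) +_) (∑-map h xs g)

∈⇒≤∑ : {xs : List A} {x : A} (g : A → ℕ) → x ∈ xs → g x ≤ ∑ xs g
∈⇒≤∑ {xs = y ∷ xs} g (here refl) = m≤m+n (g y) (∑ xs g)
∈⇒≤∑ {xs = y ∷ xs} g (there x∈xs) = ≤-trans (∈⇒≤∑ g x∈xs) (m≤n+m (∑ xs g) (g y))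

∑ᶠ : (n : ℕ) → (Fin n → ℕ) → ℕ
∑ᶠ n = ∑ (allFin n)

∑ᶠ-suc : ∀ n (g : Fin (suc n) → ℕ) → ∑ᶠ (suc n) g ≡ g fzero + ∑ᶠ n (g ∘ fsuc)
∑ᶠ-suc n g = cong (g fzero +_)
  (trans (cong (λ xs → ∑ xs g) (sym (map-tabulate id fsuc))) (∑-map fsuc (allFin n) g))

∑ˢ : (n : ℕ) → (Subset n → ℕ) → ℕ
∑ˢ n = ∑ (allSubsets n)

∑ˢ-suc : ∀ n (g : Subset (suc n) → ℕ) →
  ∑ˢ (suc n) g ≡ ∑ˢ n (g ∘ (true ∷_)) + ∑ˢ n (g ∘ (false ∷_))
∑ˢ-suc n g = trans (∑-++ (map (true ∷_) (allSubsets n)) _ g)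
  (cong₂ _+_ (∑-map (true ∷_) (allSubsets n) g) (∑-map (false ∷_) (allSubsets n) g))

-- The counters inside count and rankIn are local functions; unification against
-- their unfoldings gives them names.
mutual
  countIn : ∀ {n} → (Subset n → Bool) → List (Subset n) → ℕ
  countIn = _

  count≡countIn : ∀ {n} (p : Subset n → Bool) → count p ≡ countIn p (allSubsets n)
  count≡countIn {n} p with allSubsets n
  ... | xs = refl

mutual
  rankOver : ∀ {f} → (Fin f → Fin f) → Subset f → Fin f → List (Fin f) → ℕ
  rankOver = _

  rankIn≡rankOver : ∀ {f} (rk : Fin f → Fin f) e v → rankIn rk e v ≡ rankOver rk e v (allFin f)
  rankIn≡rankOver {f} rk e v with allFin f
  ... | xs = refl

countIn≡∑ : ∀ {n} (p : Subset n → Bool) xs → countIn p xs ≡ ∑ xs (⟦_⟧ ∘ p)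
countIn≡∑ p []       = refl
countIn≡∑ p (x ∷ xs) with p x
... | true  = cong suc (countIn≡∑ p xs)
... | false = countIn≡∑ p xs

count≡∑ : ∀ {n} (p : Subset n → Bool) → count p ≡ ∑ˢ n (⟦_⟧ ∘ p)
count≡∑ {n} p = trans (count≡countIn p) (countIn≡∑ p (allSubsets n))

rankOver≡∑ : ∀ {f} (rk : Fin f → Fin f) e v us →
  rankOver rk e v us ≡ ∑ us (λ u → ⟦ lookup e u ∧ (toℕ (rk u) <ᵇ toℕ (rk v)) ⟧)
rankOver≡∑ rk e v []       = refl
rankOver≡∑ rk e v (u ∷ us) with lookup e u ∧ (toℕ (rk u) <ᵇ toℕ (rk v))
... | true  = cong suc (rankOver≡∑ rk e v us)
... | false = rankOver≡∑ rk e v us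

rankIn≡∑ : ∀ {f} (rk : Fin f → Fin f) e v →
  rankIn rk e v ≡ ∑ᶠ f (λ u → ⟦ lookup e u ∧ (toℕ (rk u) <ᵇ toℕ (rk v)) ⟧)
rankIn≡∑ {f} rk e v = trans (rankIn≡rankOver rk e v) (rankOver≡∑ rk e v (allFin f))

-- Weighted tests and the derandomised colouring

∏ : List A → (A → ℕ) → ℕ
∏ []       g = 1
∏ (x ∷ xs) g = g x * ∏ xs g

∏-congᵃ : {xs : List A} {g h : A → ℕ} → All (λ x → g x ≡ h x) xs → ∏ xs g ≡ ∏ xs h
∏-congᵃ []         = refl
∏-congᵃ (eq ∷ eqs) = cong₂ _*_ eq (∏-congᵃ eqs)

∑ᶠ-const : ∀ n c → ∑ᶠ n (λ _ → c) ≡ n * c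
∑ᶠ-const n c = trans (∑-const c (allFin n)) (cong (_* c) (length-tabulate {n = n} id))

∑ᶠ-≡ᵇ : ∀ n {a} → a < n → ∑ᶠ n (λ x → ⟦ toℕ x ≡ᵇ a ⟧) ≡ 1
∑ᶠ-≡ᵇ (suc n) {zero} _ = trans (∑ᶠ-suc n (λ x → ⟦ toℕ x ≡ᵇ 0 ⟧))
  (cong suc (trans (∑ᶠ-const n 0) (*-zeroʳ n)))
∑ᶠ-≡ᵇ (suc n) {suc a} (s≤s a<n) = trans (∑ᶠ-suc n (λ x → ⟦ toℕ x ≡ᵇ suc a ⟧)) (∑ᶠ-≡ᵇ n a<n)

∃≤average : ∀ q (g : Fin (suc q) → ℕ) b → ∑ᶠ (suc q) g ≤ suc q * b → ∃ λ γ → g γ ≤ b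
∃≤average q g b ∑≤ with any? (λ γ → g γ ≤? b)
... | yes p = p
... | no ¬p = ⊥-elim (<⇒≱ (*-monoʳ-< (suc q) (n<1+n b)) (≤-trans lower ∑≤))
  where
  lower : suc q * suc b ≤ ∑ᶠ (suc q) g
  lower = subst (_≤ ∑ᶠ (suc q) g) (∑ᶠ-const (suc q) (suc b))
    (∑-mono (allFin (suc q)) (λ γ → ≰⇒> (λ gγ≤b → ¬p (γ , gγ≤b))))

override : DecidableEquality A → (A → B) → A → B → A → B
override _≟_ c x γ y = if does (x ≟ y) then γ else c y

override-at : (_≟_ : DecidableEquality A) (c : A → B) (x : A) (γ : B) → override _≟_ c x γ x ≡ γ
override-at _≟_ c x γ with x ≟ x
... | yes _  = refl
... | no x≢x = ⊥-elim (x≢x refl)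

override-off : (_≟_ : DecidableEquality A) (c : A → B) (x : A) (γ : B) {y : A} → x ≢ y →
  override _≟_ c x γ y ≡ c y
override-off _≟_ c x γ {y} x≢y with x ≟ y
... | yes x≡y = ⊥-elim (x≢y x≡y)
... | no _    = refl

-- The factor by which a point changes the weight of a test: the flags say whether the
-- point lies in the test and whether it gets the colour of the test.  With z = x + q the
-- average over q + 1 colours is exactly z.
factor : (x z : ℕ) → Bool → Bool → ℕ
factor x z false _     = z
factor x z true  true  = x
factor x z true  false = suc z

-- A hit weighs `q + 1` less than a miss, as `suc (x + q)` is `x + suc q`. Adding this difference
-- back at the one colour of the test makes the summand constant; the amount added is cancelled at
-- the end, so nothing is subtracted or divided.
∑-factor : ∀ x q t {a} → a < suc q →
  ∑ᶠ (suc q) (λ γ → factor x (x + q) t (toℕ γ ≡ᵇ a)) ≡ suc q * (x + q)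
∑-factor x q false a<q = ∑ᶠ-const (suc q) (x + q)
∑-factor x q true {a} a<q = +-cancelʳ-≡ (suc q * 1) _ _ (begin
  ∑ᶠ (suc q) w + suc q * 1
    ≡⟨ cong (λ s → ∑ᶠ (suc q) w + suc q * s) (sym (∑ᶠ-≡ᵇ (suc q) a<q)) ⟩
  ∑ᶠ (suc q) w + suc q * ∑ᶠ (suc q) h
    ≡⟨ cong (∑ᶠ (suc q) w +_) (sym (∑-*ˡ (suc q) (allFin (suc q)) h)) ⟩
  ∑ᶠ (suc q) w + ∑ᶠ (suc q) (λ γ → suc q * h γ)
    ≡⟨ sym (∑-+ (allFin (suc q)) w (λ γ → suc q * h γ)) ⟩
  ∑ᶠ (suc q) (λ γ → w γ + suc q * h γ)
    ≡⟨ ∑-cong (allFin (suc q)) (λ γ → pointwise (toℕ γ ≡ᵇ a)) ⟩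
  ∑ᶠ (suc q) (λ _ → suc (x + q))
    ≡⟨ ∑ᶠ-const (suc q) (suc (x + q)) ⟩
  suc q * suc (x + q)
    ≡⟨ expand q (x + q) ⟩
  suc q * (x + q) + suc q * 1 ∎)
  where
  open ≡-Reasoning
  w h : Fin (suc q) → ℕ
  w γ = factor x (x + q) true (toℕ γ ≡ᵇ a)
  h γ = ⟦ toℕ γ ≡ᵇ a ⟧
  expand : ∀ q s → suc q * suc s ≡ suc q * s + suc q * 1
  expand = solve-∀
  pointwise : ∀ b → factor x (x + q) true b + suc q * ⟦ b ⟧ ≡ suc (x + q)
  pointwise true  = trans (cong (x +_) (*-identityʳ (suc q))) (+-suc x q)
  pointwise false = trans (cong (suc (x + q) +_) (*-zeroʳ (suc q))) (+-identityʳ _)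

-- A test is a set `t τ` of points together with a colour that they should not receive too rarely.
module Colouring {X Test : Set} (_≟_ : DecidableEquality X) (x q : ℕ)
  (t : Test → X → Bool) (colour : Test → ℕ) (colour< : ∀ τ → colour τ < suc q) where

  z : ℕ
  z = x + q

  weight : (X → Fin (suc q)) → List X → Test → ℕ
  weight c ys τ = ∏ ys (λ y → factor x z (t τ y) (toℕ (c y) ≡ᵇ colour τ))

  -- Method of conditional expectations.
  ∃-colouring : (tests : List Test) (W : Test → ℕ) (ys : List X) → Unique ys →
    ∃ λ c → ∑ tests (λ τ → W τ * weight c ys τ) ≤ ∑ tests W * z ^ length ys
  ∃-colouring tests W [] [] = (λ _ → fzero) , ≤-reflexive
    (trans (∑-cong tests (λ τ → *-identityʳ (W τ))) (sym (*-identityʳ (∑ tests W))))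
  ∃-colouring tests W (y ∷ ys) (y∉ys ∷ unique) = c , (begin
    ∑ tests (λ τ → W τ * weight c (y ∷ ys) τ)
      ≡⟨ ∑-cong tests (λ τ → trans (cong (W τ *_) (cong₂ _*_ (head τ) (tail τ)))
                                   (sym (*-assoc (W τ) (φ τ γ) (weight c′ ys τ)))) ⟩
    ∑ tests (λ τ → W′ τ * weight c′ ys τ)
      ≤⟨ proj₂ rest ⟩
    ∑ tests W′ * z ^ length ys
      ≤⟨ *-monoˡ-≤ (z ^ length ys) (proj₂ choice) ⟩
    (∑ tests W * z) * z ^ length ys
      ≡⟨ *-assoc (∑ tests W) z (z ^ length ys) ⟩
    ∑ tests W * z ^ length (y ∷ ys) ∎)
    where
    open ≤-Reasoning
    φ : Test → Fin (suc q) → ℕ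
    φ τ γ = factor x z (t τ y) (toℕ γ ≡ᵇ colour τ)
    total : ∑ᶠ (suc q) (λ γ → ∑ tests (λ τ → W τ * φ τ γ)) ≡ suc q * (∑ tests W * z)
    total = begin-equality
      ∑ᶠ (suc q) (λ γ → ∑ tests (λ τ → W τ * φ τ γ))
        ≡⟨ ∑-swap (allFin (suc q)) tests (λ γ τ → W τ * φ τ γ) ⟩
      ∑ tests (λ τ → ∑ᶠ (suc q) (λ γ → W τ * φ τ γ))
        ≡⟨ ∑-cong tests (λ τ → trans (∑-*ˡ (W τ) (allFin (suc q)) (φ τ))
             (trans (cong (W τ *_) (∑-factor x q (t τ y) (colour< τ))) (*-comm (W τ) _))) ⟩
      ∑ tests (λ τ → suc q * z * W τ)
        ≡⟨ ∑-*ˡ (suc q * z) tests W ⟩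
      suc q * z * ∑ tests W
        ≡⟨ trans (*-assoc (suc q) z _) (cong (suc q *_) (*-comm z (∑ tests W))) ⟩
      suc q * (∑ tests W * z) ∎
    choice : ∃ λ γ → ∑ tests (λ τ → W τ * φ τ γ) ≤ ∑ tests W * z
    choice = ∃≤average q (λ γ → ∑ tests (λ τ → W τ * φ τ γ)) (∑ tests W * z) (≤-reflexive total)
    γ : Fin (suc q)
    γ = proj₁ choice
    -- The initial weights are arbitrary for this purpose: the factors of points that have their
    -- colour are absorbed into them before the recursive call.
    W′ : Test → ℕ
    W′ τ = W τ * φ τ γ
    rest : ∃ λ c → ∑ tests (λ τ → W′ τ * weight c ys τ) ≤ ∑ tests W′ * z ^ length ys
    rest = ∃-colouring tests W′ ys unique
    c′ c : X → Fin (suc q)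
    c′ = proj₁ rest
    c = override _≟_ c′ y γ
    head : ∀ τ → φ τ (c y) ≡ φ τ γ
    head τ = cong (φ τ) (override-at _≟_ c′ y γ)
    tail : ∀ τ → weight c ys τ ≡ weight c′ ys τ
    tail τ = ∏-congᵃ (All.map
      (λ {y′} y≢y′ → cong (λ δ → factor x z (t τ y′) (toℕ δ ≡ᵇ colour τ)) (override-off _≟_ c′ y γ y≢y′))
      y∉ys)

  module _ (c : X → Fin (suc q)) where

    hit miss : Test → X → Bool
    hit  τ y = t τ y ∧ (toℕ (c y) ≡ᵇ colour τ)
    miss τ y = t τ y ∧ not (toℕ (c y) ≡ᵇ colour τ)

    hits misses : List X → Test → ℕ
    hits   ys τ = ∑ ys (⟦_⟧ ∘ hit τ)
    misses ys τ = ∑ ys (⟦_⟧ ∘ miss τ)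

    -- Points outside the test contribute a factor `z`. One more `z` for every point inside gives
    -- the uniform `z ^ length ys`, which can be cancelled later, so that only hits and misses
    -- remain.
    weight-hits-misses : ∀ ys τ → weight c ys τ * z ^ (hits ys τ + misses ys τ) ≡
      suc z ^ misses ys τ * x ^ hits ys τ * z ^ length ys
    weight-hits-misses []       τ = refl
    weight-hits-misses (y ∷ ys) τ with t τ y | toℕ (c y) ≡ᵇ colour τ
    ... | false | _     = trans (*-assoc z _ _) (trans (cong (z *_) (weight-hits-misses ys τ))
      (shuffle z (suc z ^ misses ys τ * x ^ hits ys τ) (z ^ length ys)))
      where
      shuffle : ∀ a b c → a * (b * c) ≡ b * (a * c)
      shuffle = solve-∀
    ... | true  | true  = trans (shuffle₁ x (weight c ys τ) z _)
      (trans (cong (x * z *_) (weight-hits-misses ys τ)) (shuffle₂ x z (suc z ^ misses ys τ) (x ^ hits ys τ) _))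
      where
      shuffle₁ : ∀ x w z u → x * w * (z * u) ≡ x * z * (w * u)
      shuffle₁ = solve-∀
      shuffle₂ : ∀ x z m h l → x * z * (m * h * l) ≡ m * (x * h) * (z * l)
      shuffle₂ = solve-∀
    ... | true  | false = trans
      (cong (λ s → suc z * weight c ys τ * z ^ s) (+-suc (hits ys τ) (misses ys τ)))
      (trans (shuffle₁ (suc z) (weight c ys τ) z _)
      (trans (cong (suc z * z *_) (weight-hits-misses ys τ)) (shuffle₂ (suc z) z (suc z ^ misses ys τ) (x ^ hits ys τ) _)))
      where
      shuffle₁ : ∀ x w z u → x * w * (z * u) ≡ x * z * (w * u)
      shuffle₁ = solve-∀
      shuffle₂ : ∀ x z m h l → x * z * (m * h * l) ≡ x * m * h * (z * l)
      shuffle₂ = solve-∀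

  -- The union bound: all tests start with weight 1, and a single final weight cannot exceed the
  -- final sum of all of them.
  ∃-balanced : .{{NonZero z}} → (tests : List Test) (ys : List X) → Unique ys →
    ∃ λ c → ∀ τ → τ ∈ tests →
      suc z ^ misses c ys τ * x ^ hits c ys τ ≤ length tests * z ^ (hits c ys τ + misses c ys τ)
  ∃-balanced tests ys unique with ∃-colouring tests (λ _ → 1) ys unique
  ... | c , ∑≤ = c , λ τ τ∈ → *-cancelʳ-≤ _ _ (z ^ length ys) {{m^n≢0 z (length ys)}} (begin
    suc z ^ misses c ys τ * x ^ hits c ys τ * z ^ length ys
      ≡⟨ sym (weight-hits-misses c ys τ) ⟩
    weight c ys τ * z ^ (hits c ys τ + misses c ys τ)
      ≤⟨ *-monoˡ-≤ _ (begin
         weight c ys τ                           ≡⟨ sym (*-identityˡ _) ⟩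
         1 * weight c ys τ                       ≤⟨ ∈⇒≤∑ (λ τ → 1 * weight c ys τ) τ∈ ⟩
         ∑ tests (λ τ → 1 * weight c ys τ)       ≤⟨ ∑≤ ⟩
         ∑ tests (λ _ → 1) * z ^ length ys       ≡⟨ cong (_* z ^ length ys) (trans (∑-const 1 tests) (*-identityʳ (length tests))) ⟩
         length tests * z ^ length ys            ∎) ⟩
    length tests * z ^ length ys * z ^ (hits c ys τ + misses c ys τ)
      ≡⟨ shuffle (length tests) (z ^ length ys) _ ⟩
    length tests * z ^ (hits c ys τ + misses c ys τ) * z ^ length ys ∎)
    where
    open ≤-Reasoning
    shuffle : ∀ a b c → a * b * c ≡ a * c * b
    shuffle = solve-∀

-- From a bounded weight to balanced hits and misses

bernoulli : ∀ z m → z ^ m * (z + m) ≤ suc z ^ m * z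
bernoulli z zero    = ≤-reflexive (cong (1 *_) (+-identityʳ z))
bernoulli z (suc m) = begin
  z * z ^ m * (z + suc m)               ≤⟨ m≤m+n _ (z ^ m * m) ⟩
  z * z ^ m * (z + suc m) + z ^ m * m   ≡⟨ regroup z (z ^ m) m ⟩
  suc z * (z ^ m * (z + m))             ≤⟨ *-monoʳ-≤ (suc z) (bernoulli z m) ⟩
  suc z * (suc z ^ m * z)               ≡⟨ sym (*-assoc (suc z) (suc z ^ m) z) ⟩
  suc z * suc z ^ m * z                 ∎
  where
  open ≤-Reasoning
  regroup : ∀ z u m → z * u * (z + suc m) + u * m ≡ suc z * (u * (z + m))
  regroup = solve-∀

-- Bernoulli's inequality for `(1 - q/z)^m`, multiplied by `z^(m+1)`; the negative term stands on
-- the right to avoid truncated subtraction.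
bernoulli⁻ : ∀ x q m → let z = x + q in z ^ m * z ≤ x ^ m * z + q * m * z ^ m
bernoulli⁻ x q zero    = m≤m+n _ _
bernoulli⁻ x q (suc m) = begin
  z * z ^ m * z
    ≡⟨ regroup₁ x q (z ^ m) ⟩
  x * (z ^ m * z) + q * (z * z ^ m)
    ≤⟨ +-monoˡ-≤ _ (*-monoʳ-≤ x (bernoulli⁻ x q m)) ⟩
  x * (x ^ m * z + q * m * z ^ m) + q * (z * z ^ m)
    ≤⟨ m≤m+n _ (q * (q * m * z ^ m)) ⟩
  x * (x ^ m * z + q * m * z ^ m) + q * (z * z ^ m) + q * (q * m * z ^ m)
    ≡⟨ regroup₂ x q m (x ^ m) (z ^ m) ⟩
  x * x ^ m * z + q * suc m * (z * z ^ m) ∎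
  where
  open ≤-Reasoning
  z = x + q
  regroup₁ : ∀ x q u → (x + q) * u * (x + q) ≡ x * (u * (x + q)) + q * ((x + q) * u)
  regroup₁ = solve-∀
  regroup₂ : ∀ x q m v u →
    x * (v * (x + q) + q * m * u) + q * ((x + q) * u) + q * (q * m * u) ≡
    x * v * (x + q) + q * suc m * ((x + q) * u)
  regroup₂ = solve-∀

2*z^z≤[1+z]^z : ∀ z .{{_ : NonZero z}} → 2 * z ^ z ≤ suc z ^ z
2*z^z≤[1+z]^z z = *-cancelʳ-≤ _ _ z (begin
  2 * z ^ z * z      ≡⟨ regroup (z ^ z) z ⟩
  z ^ z * (z + z)    ≤⟨ bernoulli z z ⟩
  suc z ^ z * z      ∎)
  where
  open ≤-Reasoning
  regroup : ∀ u z → 2 * u * z ≡ u * (z + z)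
  regroup = solve-∀

-- The choice z = p (p + 1) makes (z + p + 1) (z - p) equal to z².
drift : ∀ x q d → let p = q * d ; z = x + q in .{{_ : NonZero z}} → z ≡ p * p + p →
  z ^ (suc p + d) ≤ suc z ^ suc p * x ^ d
drift x q d z≡ = *-cancelʳ-≤ _ _ (z * z) {{m*n≢0 z z}} (begin
  z ^ (suc p + d) * (z * z)
    ≡⟨ cong₂ _*_ (^-distribˡ-+-* z (suc p) d) (trans (cong₂ _*_ z≡ z≡) (trans (square p) (cong (λ s → (s + suc p) * (p * p)) (sym z≡)))) ⟩
  z ^ suc p * z ^ d * ((z + suc p) * (p * p))
    ≡⟨ regroup (z ^ suc p) (z ^ d) (z + suc p) (p * p) ⟩
  (z ^ suc p * (z + suc p)) * (z ^ d * (p * p))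
    ≤⟨ *-mono-≤ (bernoulli z (suc p)) lower ⟩
  (suc z ^ suc p * z) * (x ^ d * z)
    ≡⟨ regroup (suc z ^ suc p) z (x ^ d) z ⟩
  (suc z ^ suc p * x ^ d) * (z * z) ∎)
  where
  open ≤-Reasoning
  p = q * d
  z = x + q
  regroup : ∀ a b c e → a * b * (c * e) ≡ (a * c) * (b * e)
  regroup = solve-∀
  square : ∀ p → (p * p + p) * (p * p + p) ≡ (p * p + p + suc p) * (p * p)
  square = solve-∀
  distr : ∀ u p → u * (p * p) + p * u ≡ u * (p * p + p)
  distr = solve-∀
  lower : z ^ d * (p * p) ≤ x ^ d * z
  lower = +-cancelʳ-≤ (p * z ^ d) _ _ (begin
    z ^ d * (p * p) + p * z ^ d   ≡⟨ distr (z ^ d) p ⟩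
    z ^ d * (p * p + p)           ≡⟨ cong (z ^ d *_) (sym z≡) ⟩
    z ^ d * z                     ≤⟨ bernoulli⁻ x q d ⟩
    x ^ d * z + p * z ^ d         ∎)

^-distribʳ-* : ∀ m a b → (a * b) ^ m ≡ a ^ m * b ^ m
^-distribʳ-* zero    a b = refl
^-distribʳ-* (suc m) a b = trans (cong (a * b *_) (^-distribʳ-* m a b)) (regroup a b (a ^ m) (b ^ m))
  where
  regroup : ∀ a b c e → a * b * (c * e) ≡ (a * c) * (b * e)
  regroup = solve-∀

^-regroup : ∀ a b c d e → (a ^ b * c ^ d) ^ e ≡ a ^ (b * e) * c ^ (d * e)
^-regroup a b c d e = trans (^-distribʳ-* e (a ^ b) (c ^ d)) (cong₂ _*_ (^-*-assoc a b e) (^-*-assoc c d e))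

-- The `d`-th power of the weight has `b * d` misses and `a * d` hits. They split into `a` blocks of
-- `suc p` misses and `d` hits, which by `drift` weigh no less than neutral, `y` blocks of `z`
-- misses, each worth a factor 2, and `e` further misses. The surplus of misses thus forces a factor
-- `2 ^ y` over the neutral weight.
excess-bound : ∀ x q d y T a b e → let p = q * d ; z = x + q in .{{_ : NonZero z}} → z ≡ p * p + p →
  suc z ^ b * x ^ a ≤ T * z ^ (a + b) → b * d ≡ suc p * a + (z * y + e) → 2 ^ y ≤ T ^ d
excess-bound x q d y T a b e z≡ h bd≡ = *-cancelʳ-≤ _ _ (z ^ s) {{m^n≢0 z s}} (begin
  2 ^ y * z ^ s
    ≡⟨ cong (2 ^ y *_) (trans (^-distribˡ-+-* z ((suc p + d) * a) (z * y + e))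
         (cong (z ^ ((suc p + d) * a) *_) (^-distribˡ-+-* z (z * y) e))) ⟩
  2 ^ y * (z ^ ((suc p + d) * a) * (z ^ (z * y) * z ^ e))
    ≡⟨ regroup₁ (2 ^ y) (z ^ ((suc p + d) * a)) (z ^ (z * y)) (z ^ e) ⟩
  z ^ ((suc p + d) * a) * (2 ^ y * z ^ (z * y)) * z ^ e
    ≡⟨ cong₂ (λ u v → u * v * z ^ e) (sym (^-*-assoc z (suc p + d) a))
         (trans (cong (2 ^ y *_) (sym (^-*-assoc z z y))) (sym (^-distribʳ-* y 2 (z ^ z)))) ⟩
  (z ^ (suc p + d)) ^ a * (2 * z ^ z) ^ y * z ^ e
    ≤⟨ *-mono-≤ (*-mono-≤ (^-monoˡ-≤ a (drift x q d z≡)) (^-monoˡ-≤ y (2*z^z≤[1+z]^z z))) (^-monoˡ-≤ e (n≤1+n z)) ⟩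
  (suc z ^ suc p * x ^ d) ^ a * (suc z ^ z) ^ y * suc z ^ e
    ≡⟨ cong₂ (λ u v → u * v * suc z ^ e) (^-regroup (suc z) (suc p) x d a) (^-*-assoc (suc z) z y) ⟩
  suc z ^ (suc p * a) * x ^ (d * a) * suc z ^ (z * y) * suc z ^ e
    ≡⟨ regroup₂ (suc z ^ (suc p * a)) (x ^ (d * a)) (suc z ^ (z * y)) (suc z ^ e) ⟩
  suc z ^ (suc p * a) * (suc z ^ (z * y) * suc z ^ e) * x ^ (d * a)
    ≡⟨ cong₂ _*_ (trans (cong (suc z ^ (suc p * a) *_) (sym (^-distribˡ-+-* (suc z) (z * y) e)))
         (trans (sym (^-distribˡ-+-* (suc z) (suc p * a) (z * y + e))) (cong (suc z ^_) (sym bd≡))))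
         (cong (x ^_) (*-comm d a)) ⟩
  suc z ^ (b * d) * x ^ (a * d)
    ≡⟨ sym (^-regroup (suc z) b x a d) ⟩
  (suc z ^ b * x ^ a) ^ d
    ≤⟨ ^-monoˡ-≤ d h ⟩
  (T * z ^ (a + b)) ^ d
    ≡⟨ trans (^-distribʳ-* d T (z ^ (a + b))) (cong (T ^ d *_) (^-*-assoc z (a + b) d)) ⟩
  T ^ d * z ^ ((a + b) * d)
    ≡⟨ cong (λ s → T ^ d * z ^ s) (trans (*-distribʳ-+ d a b) (trans (cong (a * d +_) bd≡) (regroup₃ a d (suc p) (z * y + e)))) ⟩
  T ^ d * z ^ s ∎)
  where
  open ≤-Reasoning
  p = q * d
  z = x + q
  s = (suc p + d) * a + (z * y + e)
  regroup₁ : ∀ a b c e → a * (b * (c * e)) ≡ b * (a * c) * e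
  regroup₁ = solve-∀
  regroup₂ : ∀ a b c e → a * b * c * e ≡ a * (c * e) * b
  regroup₂ = solve-∀
  regroup₃ : ∀ a d p r → a * d + (p * a + r) ≡ (p + d) * a + r
  regroup₃ = solve-∀

-- One `r` in the error is the surplus `z * y` that `excess-bound` rules out; the other covers the
-- gap `a ≤ r` between `suc p * a` and `p * a` for `p = q * d`.
balance : ∀ x q d y T a b r → let z = x + q in .{{_ : NonZero z}} → z ≡ q * d * (q * d) + q * d →
  T ^ d < 2 ^ y → z * y ≡ r → a ≤ r → suc z ^ b * x ^ a ≤ T * z ^ (a + b) →
  b * d ≤ q * d * a + 2 * r
balance x q d y T a b r z≡ few zy≡r a≤r h = ≮⇒≥ impossible
  where
  regroup : ∀ p a u → suc p * a + u ≡ p * a + (a + u)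
  regroup = solve-∀
  impossible : ¬ (q * d * a + 2 * r < b * d)
  impossible large with m≤n⇒∃[o]m+o≡n excess
    where
    open ≤-Reasoning
    excess : suc (q * d) * a + (x + q) * y ≤ b * d
    excess = begin
      suc (q * d) * a + (x + q) * y   ≡⟨ cong (suc (q * d) * a +_) zy≡r ⟩
      suc (q * d) * a + r             ≡⟨ regroup (q * d) a r ⟩
      q * d * a + (a + r)             ≤⟨ +-monoʳ-≤ (q * d * a) (+-mono-≤ a≤r (m≤m+n r 0)) ⟩
      q * d * a + 2 * r               ≤⟨ <⇒≤ large ⟩
      b * d                           ∎
  ... | e , eq = <⇒≱ few (excess-bound x q d y T a b e z≡ h
    (trans (sym eq) (+-assoc (suc (q * d) * a) ((x + q) * y) e)))

-- Boolean reflection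

≡ᵇ-true⇒≡ : ∀ m n → (m ≡ᵇ n) ≡ true → m ≡ n
≡ᵇ-true⇒≡ m n eq = ≡ᵇ⇒≡ m n (Equivalence.from T-≡ eq)

≡⇒≡ᵇ-true : ∀ {m n} → m ≡ n → (m ≡ᵇ n) ≡ true
≡⇒≡ᵇ-true {m} {n} eq = Equivalence.to T-≡ (≡⇒≡ᵇ m n eq)

<ᵇ-true⇒< : ∀ m n → (m <ᵇ n) ≡ true → m < n
<ᵇ-true⇒< m n eq = <ᵇ⇒< m n (Equivalence.from T-≡ eq)

<⇒<ᵇ-true : ∀ {m n} → m < n → (m <ᵇ n) ≡ true
<⇒<ᵇ-true m<n = Equivalence.to T-≡ (<⇒<ᵇ m<n)

true-⇔⇒≡ : ∀ {a b} → (a ≡ true → b ≡ true) → (b ≡ true → a ≡ true) → a ≡ b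
true-⇔⇒≡ {true}          to from = sym (to refl)
true-⇔⇒≡ {false} {true}  to from = from refl
true-⇔⇒≡ {false} {false} to from = refl

∧-true⁺ : ∀ {a b} → a ≡ true → b ≡ true → (a ∧ b) ≡ true
∧-true⁺ refl refl = refl

∧-trueˡ : ∀ {a b} → (a ∧ b) ≡ true → a ≡ true
∧-trueˡ {true} eq = refl

∧-trueʳ : ∀ {a b} → (a ∧ b) ≡ true → b ≡ true
∧-trueʳ {true} eq = eq

∧-congᵈ : ∀ {a a′ b b′} → a ≡ a′ → (a ≡ true → b ≡ b′) → (a ∧ b) ≡ (a′ ∧ b′)
∧-congᵈ {true}  refl b≡ = b≡ refl
∧-congᵈ {false} refl b≡ = refl

⟦⟧-∧ : ∀ a b → ⟦ a ∧ b ⟧ ≡ ⟦ a ⟧ * ⟦ b ⟧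
⟦⟧-∧ true  b = sym (+-identityʳ ⟦ b ⟧)
⟦⟧-∧ false b = refl

⟦⟧-mono : ∀ {a b} → (a ≡ true → b ≡ true) → ⟦ a ⟧ ≤ ⟦ b ⟧
⟦⟧-mono {false} h = z≤n
⟦⟧-mono {true}  h = ≤-reflexive (cong ⟦_⟧ (sym (h refl)))

allᵇ⁺ : (xs : List A) (p : A → Bool) → (∀ x → p x ≡ true) → allᵇ p xs ≡ true
allᵇ⁺ []       p h = refl
allᵇ⁺ (x ∷ xs) p h = ∧-true⁺ (h x) (allᵇ⁺ xs p h)

allᵇ⁻ : (xs : List A) (p : A → Bool) → allᵇ p xs ≡ true → ∀ {x} → x ∈ xs → p x ≡ true
allᵇ⁻ (x ∷ xs) p eq (here refl) = ∧-trueˡ eq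
allᵇ⁻ (x ∷ xs) p eq (there y∈)  = allᵇ⁻ xs p (∧-trueʳ {p x} eq) y∈

allᵇ-cong : (xs : List A) {p q : A → Bool} → (∀ x → p x ≡ q x) → allᵇ p xs ≡ allᵇ q xs
allᵇ-cong []       p≗q = refl
allᵇ-cong (x ∷ xs) p≗q = cong₂ _∧_ (p≗q x) (allᵇ-cong xs p≗q)

-- Subsets: insertion, deletion and counting by size

_≟ˢ_ : ∀ {n} → DecidableEquality (Subset n)
_≟ˢ_ = ≡-dec _≟ᵇ_

insert delete : ∀ {n} → Fin n → Subset n → Subset n
insert v S = S [ v ]≔ true
delete v S = S [ v ]≔ false

lookup-insert : ∀ {n} (v : Fin n) S → lookup (insert v S) v ≡ true
lookup-insert v S = lookup∘updateAt v S

lookup-delete-≢ : ∀ {n} (v w : Fin n) S → v ≢ w → lookup (delete w S) v ≡ lookup S v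
lookup-delete-≢ v w S v≢w = lookup∘updateAt′ v w v≢w S

insert-delete : ∀ {n} (v : Fin n) S → lookup S v ≡ true → insert v (delete v S) ≡ S
insert-delete v S v∈S = trans (updateAt-updateAt v S) (updateAt-id-local v S (sym v∈S))

delete-insert : ∀ {n} (v : Fin n) S → lookup S v ≡ false → delete v (insert v S) ≡ S
delete-insert v S v∉S = trans (updateAt-updateAt v S) (updateAt-id-local v S (sym v∉S))

∣delete∣ : ∀ {n} (v : Fin n) S → lookup S v ≡ true → suc ∣ delete v S ∣ ≡ ∣ S ∣
∣delete∣ fzero    (true ∷ S)  v∈S = refl
∣delete∣ (fsuc v) (true ∷ S)  v∈S = cong suc (∣delete∣ v S v∈S)
∣delete∣ (fsuc v) (false ∷ S) v∈S = ∣delete∣ v S v∈S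

allSubsets-unique : ∀ n → Unique (allSubsets n)
allSubsets-unique zero    = [] ∷ []
allSubsets-unique (suc n) = ++⁺ (map⁺ (λ { refl → refl }) (allSubsets-unique n))
  (map⁺ (λ { refl → refl }) (allSubsets-unique n)) (λ (p , q) → disjoint p q)
  where
  disjoint : ∀ {S} → S ∈ map (true ∷_) (allSubsets n) → S ∈ map (false ∷_) (allSubsets n) → ⊥
  disjoint p q with ∈-map⁻ (true ∷_) p | ∈-map⁻ (false ∷_) q
  ... | _ , _ , refl | _ , _ , ()

∈-allSubsets : ∀ {n} (S : Subset n) → S ∈ allSubsets n
∈-allSubsets []          = here refl
∈-allSubsets (true ∷ S)  = ∈-++⁺ˡ (∈-map⁺ (true ∷_) (∈-allSubsets S))
∈-allSubsets {suc n} (false ∷ S) = ∈-++⁺ʳ (map (true ∷_) (allSubsets n)) (∈-map⁺ (false ∷_) (∈-allSubsets S))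

∑ˢ-size≤ : ∀ n s → ∑ˢ n (λ S → ⟦ ∣ S ∣ ≡ᵇ s ⟧) ≤ n ^ s
∑ˢ-size≤ zero    zero    = s≤s z≤n
∑ˢ-size≤ zero    (suc s) = z≤n
∑ˢ-size≤ (suc n) zero    = ≤-trans (≤-reflexive (trans (∑ˢ-suc n _)
  (cong (_+ ∑ˢ n (λ S → ⟦ ∣ S ∣ ≡ᵇ 0 ⟧)) (trans (∑-const 0 (allSubsets n)) (*-zeroʳ (length (allSubsets n))))))) (∑ˢ-size≤ n zero)
∑ˢ-size≤ (suc n) (suc s) = begin
  ∑ˢ (suc n) (λ S → ⟦ ∣ S ∣ ≡ᵇ suc s ⟧)
    ≡⟨ ∑ˢ-suc n _ ⟩
  ∑ˢ n (λ S → ⟦ ∣ S ∣ ≡ᵇ s ⟧) + ∑ˢ n (λ S → ⟦ ∣ S ∣ ≡ᵇ suc s ⟧)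
    ≤⟨ +-mono-≤ (∑ˢ-size≤ n s) (∑ˢ-size≤ n (suc s)) ⟩
  n ^ s + n * n ^ s
    ≤⟨ *-monoʳ-≤ (suc n) (^-monoˡ-≤ s (n≤1+n n)) ⟩
  suc n * suc n ^ s ∎
  where open ≤-Reasoning

∑ˢ-insert : ∀ n (v : Fin n) (g : Subset n → ℕ) →
  ∑ˢ n (λ e → ⟦ lookup e v ⟧ * g e) ≡ ∑ˢ n (λ S → ⟦ not (lookup S v) ⟧ * g (insert v S))
∑ˢ-insert (suc n) fzero g = begin
  ∑ˢ (suc n) (λ e → ⟦ lookup e fzero ⟧ * g e)
    ≡⟨ ∑ˢ-suc n _ ⟩
  ∑ˢ n (λ e → 1 * g (true ∷ e)) + ∑ˢ n (λ _ → 0)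
    ≡⟨ +-comm (∑ˢ n (λ e → 1 * g (true ∷ e))) _ ⟩
  ∑ˢ n (λ _ → 0) + ∑ˢ n (λ e → 1 * g (true ∷ e))
    ≡⟨ sym (∑ˢ-suc n _) ⟩
  ∑ˢ (suc n) (λ S → ⟦ not (lookup S fzero) ⟧ * g (insert fzero S)) ∎
  where open ≡-Reasoning
∑ˢ-insert (suc n) (fsuc v) g = begin
  ∑ˢ (suc n) (λ e → ⟦ lookup e (fsuc v) ⟧ * g e)
    ≡⟨ ∑ˢ-suc n _ ⟩
  ∑ˢ n (λ e → ⟦ lookup e v ⟧ * g (true ∷ e)) + ∑ˢ n (λ e → ⟦ lookup e v ⟧ * g (false ∷ e))
    ≡⟨ cong₂ _+_ (∑ˢ-insert n v _) (∑ˢ-insert n v _) ⟩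
  ∑ˢ n (λ S → ⟦ not (lookup S v) ⟧ * g (true ∷ insert v S)) +
    ∑ˢ n (λ S → ⟦ not (lookup S v) ⟧ * g (false ∷ insert v S))
    ≡⟨ sym (∑ˢ-suc n _) ⟩
  ∑ˢ (suc n) (λ S → ⟦ not (lookup S (fsuc v)) ⟧ * g (insert (fsuc v) S)) ∎
  where open ≡-Reasoning

-- Positions of vertices in a set

pos : ∀ {n} → Subset n → Fin n → ℕ
pos (b ∷ e) fzero    = 0
pos (b ∷ e) (fsuc v) = ⟦ b ⟧ + pos e v

pos<∣∣ : ∀ {n} (e : Subset n) v → lookup e v ≡ true → pos e v < ∣ e ∣
pos<∣∣ (true ∷ e)  fzero    v∈e = s≤s z≤n
pos<∣∣ (true ∷ e)  (fsuc v) v∈e = s≤s (pos<∣∣ e v v∈e)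
pos<∣∣ (false ∷ e) (fsuc v) v∈e = pos<∣∣ e v v∈e

∃-pos : ∀ {n} (e : Subset n) m → m < ∣ e ∣ → ∃ λ v → lookup e v ≡ true × pos e v ≡ m
∃-pos (true ∷ e)  zero    m<       = fzero , refl , refl
∃-pos (true ∷ e)  (suc m) (s≤s m<) with ∃-pos e m m<
... | v , v∈e , eq = fsuc v , v∈e , cong suc eq
∃-pos (false ∷ e) m       m<       with ∃-pos e m m<
... | v , v∈e , eq = fsuc v , v∈e , eq

pos-injective : ∀ {n} (e : Subset n) v w → lookup e v ≡ true → lookup e w ≡ true →
  pos e v ≡ pos e w → v ≡ w
pos-injective e           fzero    fzero    v∈ w∈ eq = refl
pos-injective (true ∷ e)  (fsuc v) (fsuc w) v∈ w∈ eq = cong fsuc (pos-injective e v w v∈ w∈ (suc-injective eq))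
pos-injective (false ∷ e) (fsuc v) (fsuc w) v∈ w∈ eq = cong fsuc (pos-injective e v w v∈ w∈ eq)
pos-injective (true ∷ e)  fzero    (fsuc w) v∈ w∈ ()
pos-injective (true ∷ e)  (fsuc v) fzero    v∈ w∈ ()

∑-pos : ∀ {n} (e : Subset n) m → m < ∣ e ∣ → ∑ᶠ n (λ v → ⟦ lookup e v ⟧ * ⟦ pos e v ≡ᵇ m ⟧) ≡ 1
∑-pos {suc n} (true ∷ e) zero m<  = trans (∑ᶠ-suc n (λ v → ⟦ lookup (true ∷ e) v ⟧ * ⟦ pos (true ∷ e) v ≡ᵇ 0 ⟧))
  (cong suc (trans (∑-cong (allFin n) (λ v → *-zeroʳ ⟦ lookup e v ⟧)) (trans (∑ᶠ-const n 0) (*-zeroʳ n))))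
∑-pos {suc n} (true ∷ e) (suc m) (s≤s m<) =
  trans (∑ᶠ-suc n (λ v → ⟦ lookup (true ∷ e) v ⟧ * ⟦ pos (true ∷ e) v ≡ᵇ suc m ⟧)) (∑-pos e m m<)
∑-pos {suc n} (false ∷ e) m m< =
  trans (∑ᶠ-suc n (λ v → ⟦ lookup (false ∷ e) v ⟧ * ⟦ pos (false ∷ e) v ≡ᵇ m ⟧)) (∑-pos e m m<)

-- A `k`-set has exactly one vertex `v` at position `m`. Sorting by `v` and removing it turns a
-- count of `k`-sets into counts of `(k-1)`-sets, the objects that carry colours.
∑ˢ-by-position : ∀ {n} k (p : Subset n → Bool) → (∀ e → p e ≡ true → ∣ e ∣ ≡ k) → ∀ m → m < k →
  ∑ˢ n (⟦_⟧ ∘ p) ≡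
  ∑ᶠ n (λ v → ∑ˢ n (λ S → ⟦ not (lookup S v) ∧ ((pos (insert v S) v ≡ᵇ m) ∧ p (insert v S)) ⟧))
∑ˢ-by-position {n} k p size m m<k = begin
  ∑ˢ n (⟦_⟧ ∘ p)
    ≡⟨ ∑-cong (allSubsets n) expand ⟩
  ∑ˢ n (λ e → ∑ᶠ n (λ v → ⟦ lookup e v ⟧ * ⟦ (pos e v ≡ᵇ m) ∧ p e ⟧))
    ≡⟨ ∑-swap (allSubsets n) (allFin n) _ ⟩
  ∑ᶠ n (λ v → ∑ˢ n (λ e → ⟦ lookup e v ⟧ * ⟦ (pos e v ≡ᵇ m) ∧ p e ⟧))
    ≡⟨ ∑-cong (allFin n) (λ v → trans (∑ˢ-insert n v _)
         (∑-cong (allSubsets n) (λ S → sym (⟦⟧-∧ (not (lookup S v)) _)))) ⟩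
  ∑ᶠ n (λ v → ∑ˢ n (λ S → ⟦ not (lookup S v) ∧ ((pos (insert v S) v ≡ᵇ m) ∧ p (insert v S)) ⟧)) ∎
  where
  open ≡-Reasoning
  shuffle : ∀ a b c → c * (a * b) ≡ a * (b * c)
  shuffle = solve-∀
  expand : ∀ e → ⟦ p e ⟧ ≡ ∑ᶠ n (λ v → ⟦ lookup e v ⟧ * ⟦ (pos e v ≡ᵇ m) ∧ p e ⟧)
  expand e = trans (weigh (p e) refl)
    (trans (sym (∑-*ˡ ⟦ p e ⟧ (allFin n) (λ v → ⟦ lookup e v ⟧ * ⟦ pos e v ≡ᵇ m ⟧)))
    (∑-cong (allFin n) (λ v → trans (shuffle ⟦ lookup e v ⟧ ⟦ pos e v ≡ᵇ m ⟧ ⟦ p e ⟧)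
      (cong (⟦ lookup e v ⟧ *_) (sym (⟦⟧-∧ (pos e v ≡ᵇ m) (p e)))))))
    where
    weigh : ∀ b → p e ≡ b → ⟦ b ⟧ ≡ ⟦ b ⟧ * ∑ᶠ n (λ v → ⟦ lookup e v ⟧ * ⟦ pos e v ≡ᵇ m ⟧)
    weigh false _  = refl
    weigh true  pe = sym (trans (*-identityˡ _) (∑-pos e m (subst (m <_) (sym (size e pe)) m<k)))

-- Faces that follow a pattern of colours

-- The cut-off `m` is the induction variable of the density argument: every set fits at `m = 0`, and
-- at `m = ∣ e ∣` all faces are prescribed.
fits : ∀ {n q} → (Subset n → Fin q) → (ℕ → ℕ) → ℕ → Subset n → Bool
fits {n} c P m e = allᵇ
  (λ w → not (lookup e w ∧ (pos e w <ᵇ m)) ∨ (toℕ (c (delete w e)) ≡ᵇ P (pos e w))) (allFin n)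

not-∨⁺ : ∀ {a b} → (a ≡ true → b ≡ true) → (not a ∨ b) ≡ true
not-∨⁺ {true}  h = h refl
not-∨⁺ {false} h = refl

not-∨⁻ : ∀ {a b} → (not a ∨ b) ≡ true → a ≡ true → b ≡ true
not-∨⁻ {true} h refl = h

Fits : ∀ {n q} → (Subset n → Fin q) → (ℕ → ℕ) → ℕ → Subset n → Set
Fits c P m e = ∀ w → lookup e w ≡ true → pos e w < m → toℕ (c (delete w e)) ≡ P (pos e w)

fits⁺ : ∀ {n q} (c : Subset n → Fin q) P m e → Fits c P m e → fits c P m e ≡ true
fits⁺ {n} c P m e h = allᵇ⁺ (allFin n) _ (λ w → not-∨⁺ (λ eq → ≡⇒≡ᵇ-true
  (h w (∧-trueˡ eq) (<ᵇ-true⇒< (pos e w) m (∧-trueʳ {lookup e w} eq)))))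

fits⁻ : ∀ {n q} (c : Subset n → Fin q) P m e → fits c P m e ≡ true → Fits c P m e
fits⁻ {n} c P m e eq w w∈e pos< = ≡ᵇ-true⇒≡ _ (P (pos e w))
  (not-∨⁻ {lookup e w ∧ (pos e w <ᵇ m)} (allᵇ⁻ (allFin n) _ eq (∈-allFin w)) (∧-true⁺ w∈e (<⇒<ᵇ-true pos<)))

fits-zero : ∀ {n q} (c : Subset n → Fin q) P e → fits c P 0 e ≡ true
fits-zero c P e = fits⁺ c P 0 e (λ _ _ ())

fits-suc : ∀ {n q} (c : Subset n → Fin q) P m e v → lookup e v ≡ true → pos e v ≡ m →
  fits c P (suc m) e ≡ (fits c P m e ∧ (toℕ (c (delete v e)) ≡ᵇ P m))
fits-suc c P m e v v∈e refl = true-⇔⇒≡ to from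
  where
  to : fits c P (suc m) e ≡ true → (fits c P m e ∧ (toℕ (c (delete v e)) ≡ᵇ P m)) ≡ true
  to eq = let h = fits⁻ c P (suc m) e eq in
    ∧-true⁺ (fits⁺ c P m e (λ w w∈e lt → h w w∈e (m<n⇒m<1+n lt))) (≡⇒≡ᵇ-true (h v v∈e (n<1+n m)))
  from : (fits c P m e ∧ (toℕ (c (delete v e)) ≡ᵇ P m)) ≡ true → fits c P (suc m) e ≡ true
  from eq = fits⁺ c P (suc m) e λ w w∈e lt → step w w∈e (m<1+n⇒m<n∨m≡n lt)
    where
    step : ∀ w → lookup e w ≡ true → pos e w < m ⊎ pos e w ≡ m → toℕ (c (delete w e)) ≡ P (pos e w)
    step w w∈e (inj₁ lt) = fits⁻ c P m e (∧-trueˡ eq) w w∈e lt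
    step w w∈e (inj₂ eq′) with pos-injective e w v w∈e v∈e eq′
    ... | refl = ≡ᵇ-true⇒≡ _ (P m) (∧-trueʳ {fits c P m e} eq)

fits-cong : ∀ {n q} (c c′ : Subset n → Fin q) P m e →
  (∀ w → lookup e w ≡ true → pos e w < m → c (delete w e) ≡ c′ (delete w e)) →
  fits c P m e ≡ fits c′ P m e
fits-cong c c′ P m e agree = true-⇔⇒≡
  (λ eq → fits⁺ c′ P m e λ w w∈e lt → trans (cong toℕ (sym (agree w w∈e lt))) (fits⁻ c P m e eq w w∈e lt))
  (λ eq → fits⁺ c P m e λ w w∈e lt → trans (cong toℕ (agree w w∈e lt)) (fits⁻ c′ P m e eq w w∈e lt))

inK-size : ∀ {n} k j (G : Subset n → Bool) S → inK k j G S ≡ true → ∣ S ∣ ≡ k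
inK-size k j G S eq = ≡ᵇ-true⇒≡ ∣ S ∣ k (∧-trueˡ eq)

inK-cong : ∀ {n} k j (G G′ : Subset n → Bool) → (∀ R → ∣ R ∣ ≡ j → G R ≡ G′ R) →
  ∀ S → inK k j G S ≡ inK k j G′ S
inK-cong {n} k j G G′ agree S = cong ((∣ S ∣ ≡ᵇ k) ∧_) (allᵇ-cong (allSubsets n) pointwise)
  where
  pointwise : ∀ R → (not (subsetᵇ R S ∧ (∣ R ∣ ≡ᵇ j)) ∨ G R) ≡ (not (subsetᵇ R S ∧ (∣ R ∣ ≡ᵇ j)) ∨ G′ R)
  pointwise R with subsetᵇ R S | ∣ R ∣ ≡ᵇ j in eq
  ... | false | _     = refl
  ... | true  | false = refl
  ... | true  | true  = agree R (≡ᵇ-true⇒≡ ∣ R ∣ j eq)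

-- Listing all labellings

length-cartesianProductWith : {C : Set} (h : A → B → C) (xs : List A) (ys : List B) →
  length (cartesianProductWith h xs ys) ≡ length xs * length ys
length-cartesianProductWith h []       ys = refl
length-cartesianProductWith h (x ∷ xs) ys = trans (length-++ (map (h x) ys))
  (cong₂ _+_ (length-map (h x) ys) (length-cartesianProductWith h xs ys))

module _ (_≟_ : DecidableEquality A) (values : List B) (default : B) where

  functions : List A → List (A → B)
  functions []       = (λ _ → default) ∷ []
  functions (x ∷ xs) = cartesianProductWith (λ γ g → override _≟_ g x γ) values (functions xs)

  length-functions : ∀ xs → length (functions xs) ≡ length values ^ length xs
  length-functions []       = refl
  length-functions (x ∷ xs) = trans (length-cartesianProductWith _ values (functions xs))
    (cong (length values *_) (length-functions xs))

  -- Agreement on the listed points replaces equality of functions. It is enough here because a test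
  -- reads its labelling only at sets of one size.
  functions-complete : ∀ xs (h : A → B) → (∀ x → h x ∈ values) →
    ∃ λ g → g ∈ functions xs × (∀ {x} → x ∈ xs → g x ≡ h x)
  functions-complete []       h h∈ = (λ _ → default) , here refl , λ ()
  functions-complete (x ∷ xs) h h∈ with functions-complete xs h h∈
  ... | g , g∈ , agree =
    override _≟_ g x (h x) , ∈-cartesianProductWith⁺ _ (h∈ x) g∈ , agree′
    where
    agree′ : ∀ {y} → y ∈ (x ∷ xs) → override _≟_ g x (h x) y ≡ h y
    agree′ {y} y∈ with x ≟ y
    agree′ {y} y∈         | yes refl = refl
    agree′ {y} (here y≡x) | no x≢y   = ⊥-elim (x≢y (sym y≡x))
    agree′ {y} (there y∈) | no x≢y   = agree y∈

subsetsOfSize : ∀ n → ℕ → List (Subset n)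
subsetsOfSize n j = filterᵇ (λ S → ∣ S ∣ ≡ᵇ j) (allSubsets n)

length-filterᵇ : (p : A → Bool) (xs : List A) → length (filterᵇ p xs) ≡ ∑ xs (⟦_⟧ ∘ p)
length-filterᵇ p []       = refl
length-filterᵇ p (x ∷ xs) with p x
... | true  = cong suc (length-filterᵇ p xs)
... | false = length-filterᵇ p xs

∈-filterᵇ⁺ : (p : A → Bool) {x : A} {xs : List A} → x ∈ xs → p x ≡ true → x ∈ filterᵇ p xs
∈-filterᵇ⁺ p {xs = x ∷ xs} (here refl) px rewrite px = here refl
∈-filterᵇ⁺ p {xs = y ∷ xs} (there x∈)  px with p y
... | true  = there (∈-filterᵇ⁺ p x∈ px)
... | false = ∈-filterᵇ⁺ p x∈ px

-- A colouring that passes every test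

module Quasirandom (j q s n : ℕ) (pat : Fin s → ℕ → ℕ)
  (pat< : ∀ a m → m < suc (suc j) → pat a m < suc q) where

  k : ℕ
  k = suc (suc j)

  -- The Boolean guesses whether a `(k-2)`-set is an edge of `G`, the other component guesses the
  -- colour of the `(k-1)`-set that it forms with the vertex of the test.
  Labelling : Set
  Labelling = Subset n → Bool × Fin (suc q)

  Test : Set
  Test = (Fin s × Fin k) × (Fin n × Labelling)

  -- A test fixes a vertex v and describes, by labels of (k-2)-sets, which (k-1)-sets S
  -- complete with v to a clique of G whose faces at positions below m fit the pattern.
  test : Test → Subset n → Bool
  test ((a , m) , (v , D)) S = not (lookup S v) ∧ ((pos e v ≡ᵇ toℕ m) ∧
    (inK k j (proj₁ ∘ D) e ∧ fits (λ R → proj₂ (D (delete v R))) (pat a) (toℕ m) e))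
    where e = insert v S

  colour : Test → ℕ
  colour ((a , m) , _) = pat a (toℕ m)

  labels : List (Bool × Fin (suc q))
  labels = cartesianProduct (true ∷ false ∷ []) (allFin (suc q))

  ∈-labels : ∀ l → l ∈ labels
  ∈-labels (b , γ) = ∈-cartesianProduct⁺ (∈-Bool b) (∈-allFin γ)
    where
    ∈-Bool : ∀ b → b ∈ (true ∷ false ∷ [])
    ∈-Bool true  = here refl
    ∈-Bool false = there (here refl)

  labellings : List Labelling
  labellings = functions _≟ˢ_ labels (true , fzero) (subsetsOfSize n j)

  tests : List Test
  tests = cartesianProduct (cartesianProduct (allFin s) (allFin k)) (cartesianProduct (allFin n) labellings)

  length-tests : length tests ≤ s * k * (n * (2 * suc q) ^ (n ^ j))
  length-tests = begin
    length tests
      ≡⟨ length-cartesianProductWith _,_ (cartesianProduct (allFin s) (allFin k)) _ ⟩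
    length (cartesianProduct (allFin s) (allFin k)) * length (cartesianProduct (allFin n) labellings)
      ≡⟨ cong₂ _*_
           (trans (length-cartesianProductWith _,_ (allFin s) (allFin k))
             (cong₂ _*_ (length-tabulate {n = s} id) (length-tabulate {n = k} id)))
           (trans (length-cartesianProductWith _,_ (allFin n) labellings)
             (cong₂ _*_ (length-tabulate {n = n} id)
               (length-functions _≟ˢ_ labels (true , fzero) (subsetsOfSize n j)))) ⟩
    s * k * (n * length labels ^ length (subsetsOfSize n j))
      ≡⟨ cong₂ (λ a b → s * k * (n * a ^ b))
           (trans (length-cartesianProductWith _,_ (true ∷ false ∷ []) (allFin (suc q)))
             (cong (2 *_) (length-tabulate {n = suc q} id)))
           (length-filterᵇ (λ S → ∣ S ∣ ≡ᵇ j) (allSubsets n)) ⟩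
    s * k * (n * (2 * suc q) ^ ∑ˢ n (λ S → ⟦ ∣ S ∣ ≡ᵇ j ⟧))
      ≤⟨ *-monoʳ-≤ (s * k) (*-monoʳ-≤ n (^-monoʳ-≤ (2 * suc q) (∑ˢ-size≤ n j))) ⟩
    s * k * (n * (2 * suc q) ^ (n ^ j)) ∎
    where open ≤-Reasoning

  test-size : ∀ τ S → test τ S ≡ true → ∣ S ∣ ≡ suc j
  test-size ((a , m) , (v , D)) S eq = suc-injective (begin
    suc ∣ S ∣                       ≡⟨ cong (suc ∘ ∣_∣) (sym (delete-insert v S v∉S)) ⟩
    suc ∣ delete v (insert v S) ∣   ≡⟨ ∣delete∣ v (insert v S) (lookup-insert v S) ⟩
    ∣ insert v S ∣                  ≡⟨ inK-size k j (proj₁ ∘ D) (insert v S)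
                                        (∧-trueˡ (∧-trueʳ {pos (insert v S) v ≡ᵇ toℕ m} (∧-trueʳ {not (lookup S v)} eq))) ⟩
    suc (suc j)                     ∎)
    where
    open ≡-Reasoning
    v∉S : lookup S v ≡ false
    v∉S = not-injective (∧-trueˡ eq)

  earlier≢ : ∀ {m} (e : Subset n) v w → pos e v ≡ m → pos e w < m → v ≢ w
  earlier≢ e v w refl lt refl = <-irrefl refl lt

  -- A face prescribed below position `m` omits a vertex other than `v`, since `v` has position `m`.
  -- So it contains `v` and is determined by its other `k-2` vertices; `G` is read only at
  -- `(k-2)`-sets anyway.
  test-cong : ∀ a m v (D D′ : Labelling) → (∀ R → ∣ R ∣ ≡ j → D R ≡ D′ R) →
    ∀ S → test ((a , m) , (v , D)) S ≡ test ((a , m) , (v , D′)) S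
  test-cong a m v D D′ agree S = cong (not (lookup S v) ∧_)
    (∧-congᵈ {pos e v ≡ᵇ toℕ m} refl λ pos≡ →
     ∧-congᵈ {inK k j (proj₁ ∘ D) e} (inK-cong k j (proj₁ ∘ D) (proj₁ ∘ D′) (λ R → cong proj₁ ∘ agree R) e) λ inK≡ →
     fits-cong (λ R → proj₂ (D (delete v R))) (λ R → proj₂ (D′ (delete v R))) (pat a) (toℕ m) e λ w w∈e lt →
       let v≢w = earlier≢ e v w (≡ᵇ-true⇒≡ (pos e v) (toℕ m) pos≡) lt in
       cong proj₂ (agree (delete v (delete w e)) (suc-injective (suc-injective (begin
         suc (suc ∣ delete v (delete w e) ∣)
           ≡⟨ cong suc (∣delete∣ v (delete w e) (trans (lookup-delete-≢ v w e v≢w) (lookup-insert v S))) ⟩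
         suc ∣ delete w e ∣
           ≡⟨ ∣delete∣ w e w∈e ⟩
         ∣ e ∣
           ≡⟨ inK-size k j (proj₁ ∘ D) e inK≡ ⟩
         suc (suc j) ∎)))))
    where
    open ≡-Reasoning
    e = insert v S

  module _ (x d y : ℕ) .{{z≢0 : NonZero (x + q)}} (z≡ : x + q ≡ q * d * (q * d) + q * d)
    (few : (s * k * (n * (2 * suc q) ^ (n ^ j))) ^ d < 2 ^ y) (zy≡ : (x + q) * y ≡ n ^ suc j) where

    open Colouring _≟ˢ_ x q test colour (λ ((a , m) , _) → pat< a (toℕ m) (toℕ<n m))

    fitting : (Subset n → Fin (suc q)) → (Subset n → Bool) → Fin s → ℕ → ℕ
    fitting c G a m = ∑ˢ n (λ e → ⟦ inK k j G e ∧ fits c (pat a) m e ⟧)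

    -- Among `q + 1` colours about `q` misses per hit are expected; the tolerated surplus is `2 / d`
    -- times n^(k-1). A surplus of hits is not restricted, as density is a lower bound.
    Balanced : (Subset n → Fin (suc q)) → Test → Set
    Balanced c τ = misses c (allSubsets n) τ * d ≤ q * d * hits c (allSubsets n) τ + 2 * n ^ suc j

    ∃-colouring-balanced : ∃ λ c → ∀ τ → τ ∈ tests → Balanced c τ
    ∃-colouring-balanced = c , λ τ τ∈ →
      balance x q d y (length tests) (hits c (allSubsets n) τ) (misses c (allSubsets n) τ) (n ^ suc j) z≡
        (≤-<-trans (^-monoˡ-≤ d length-tests) few) zy≡
        (≤-trans (∑-mono (allSubsets n) (hit≤ τ)) (∑ˢ-size≤ n (suc j))) (proj₂ colouring τ τ∈)
      where
      colouring : ∃ λ c → ∀ τ → τ ∈ tests → suc z ^ misses c (allSubsets n) τ * x ^ hits c (allSubsets n) τ ≤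
        length tests * z ^ (hits c (allSubsets n) τ + misses c (allSubsets n) τ)
      colouring = ∃-balanced tests (allSubsets n) (allSubsets-unique n)
      c : Subset n → Fin (suc q)
      c = proj₁ colouring
      hit≤ : ∀ τ S → ⟦ hit c τ S ⟧ ≤ ⟦ ∣ S ∣ ≡ᵇ suc j ⟧
      hit≤ τ S = ⟦⟧-mono {hit c τ S} λ eq → ≡⇒≡ᵇ-true (test-size τ S (∧-trueˡ {test τ S} eq))

    balanced-all : ∀ c → (∀ τ → τ ∈ tests → Balanced c τ) → ∀ τ → Balanced c τ
    balanced-all c bal ((a , m) , (v , D)) = subst₂ (λ u w → u * d ≤ q * d * w + 2 * n ^ suc j)
      (∑-cong (allSubsets n) (λ S → cong (λ b → ⟦ b ∧ not (toℕ (c S) ≡ᵇ pat a (toℕ m)) ⟧) (same S)))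
      (∑-cong (allSubsets n) (λ S → cong (λ b → ⟦ b ∧ (toℕ (c S) ≡ᵇ pat a (toℕ m)) ⟧) (same S)))
      (bal ((a , m) , (v , D′)) (∈-cartesianProduct⁺ (∈-cartesianProduct⁺ (∈-allFin a) (∈-allFin m))
        (∈-cartesianProduct⁺ (∈-allFin v) (proj₁ (proj₂ listed)))))
      where
      listed : ∃ λ D′ → D′ ∈ labellings × (∀ {R} → R ∈ subsetsOfSize n j → D′ R ≡ D R)
      listed = functions-complete _≟ˢ_ labels (true , fzero) (subsetsOfSize n j) D (λ R → ∈-labels (D R))
      D′ : Labelling
      D′ = proj₁ listed
      same : ∀ S → test ((a , m) , (v , D′)) S ≡ test ((a , m) , (v , D)) S
      same = test-cong a m v D′ D (λ R size →
        proj₂ (proj₂ listed) (∈-filterᵇ⁺ (λ S → ∣ S ∣ ≡ᵇ j) (∈-allSubsets R) (≡⇒≡ᵇ-true size)))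

    module _ (c : Subset n → Fin (suc q)) (G : Subset n → Bool) (a : Fin s) (m : Fin k) where

      -- The guess is now read off from the finished colouring and from `G`. This dependence is
      -- harmless because all guesses were balanced simultaneously.
      extension : Fin n → Test
      extension v = (a , m) , (v , λ R → G R , c (insert v R))

      test-extension : ∀ v S → test (extension v) S ≡ (not (lookup S v) ∧ ((pos (insert v S) v ≡ᵇ toℕ m) ∧
        (inK k j G (insert v S) ∧ fits c (pat a) (toℕ m) (insert v S))))
      test-extension v S = cong (not (lookup S v) ∧_) (∧-congᵈ {pos e v ≡ᵇ toℕ m} refl λ pos≡ →
        cong (inK k j G e ∧_) (fits-cong (λ R → c (insert v (delete v R))) c (pat a) (toℕ m) e λ w w∈e lt →
          let v≢w = earlier≢ e v w (≡ᵇ-true⇒≡ (pos e v) (toℕ m) pos≡) lt in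
          cong c (insert-delete v (delete w e) (trans (lookup-delete-≢ v w e v≢w) (lookup-insert v S)))))
        where e = insert v S

      -- The face of `insert v S` at position `m` is `S` itself, so a hit extends the fit by exactly
      -- one position.
      hit-extension : ∀ v S → hit c (extension v) S ≡ (not (lookup S v) ∧ ((pos (insert v S) v ≡ᵇ toℕ m) ∧
        (inK k j G (insert v S) ∧ fits c (pat a) (suc (toℕ m)) (insert v S))))
      hit-extension v S = begin
        test (extension v) S ∧ h
          ≡⟨ cong (_∧ h) (test-extension v S) ⟩
        (not (lookup S v) ∧ (p ∧ (i ∧ f))) ∧ h
          ≡⟨ trans (∧-assoc (not (lookup S v)) (p ∧ (i ∧ f)) h) (cong (not (lookup S v) ∧_)
               (trans (∧-assoc p (i ∧ f) h) (cong (p ∧_) (∧-assoc i f h)))) ⟩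
        not (lookup S v) ∧ (p ∧ (i ∧ (f ∧ h)))
          ≡⟨ ∧-congᵈ {not (lookup S v)} refl (λ v∉ → ∧-congᵈ {p} refl (λ pos≡ → cong (i ∧_)
               (sym (trans (fits-suc c (pat a) (toℕ m) e v (lookup-insert v S) (≡ᵇ-true⇒≡ (pos e v) (toℕ m) pos≡))
                 (cong (λ R → f ∧ (toℕ (c R) ≡ᵇ pat a (toℕ m))) (delete-insert v S (not-injective v∉))))))) ⟩
        not (lookup S v) ∧ (p ∧ (i ∧ fits c (pat a) (suc (toℕ m)) e)) ∎
        where
        open ≡-Reasoning
        e = insert v S
        h = toℕ (c S) ≡ᵇ pat a (toℕ m)
        p = pos e v ≡ᵇ toℕ m
        i = inK k j G e
        f = fits c (pat a) (toℕ m) e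

      fitting-size : ∀ m e → (inK k j G e ∧ fits c (pat a) m e) ≡ true → ∣ e ∣ ≡ k
      fitting-size m e eq = inK-size k j G e (∧-trueˡ eq)

      H M : Fin n → ℕ
      H v = hits c (allSubsets n) (extension v)
      M v = misses c (allSubsets n) (extension v)

      fitting-suc≡hits : fitting c G a (suc (toℕ m)) ≡ ∑ᶠ n H
      fitting-suc≡hits = trans (∑ˢ-by-position k (λ e → inK k j G e ∧ fits c (pat a) (suc (toℕ m)) e) (fitting-size (suc (toℕ m))) (toℕ m) (toℕ<n m))
        (∑-cong (allFin n) (λ v → ∑-cong (allSubsets n) (λ S → cong ⟦_⟧ (sym (hit-extension v S)))))

      fitting≡hits+misses : fitting c G a (toℕ m) ≡ ∑ᶠ n H + ∑ᶠ n M
      fitting≡hits+misses = trans (∑ˢ-by-position k (λ e → inK k j G e ∧ fits c (pat a) (toℕ m) e) (fitting-size (toℕ m)) (toℕ m) (toℕ<n m))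
        (trans (∑-cong (allFin n) (λ v → trans (∑-cong (allSubsets n) (λ S →
            trans (cong ⟦_⟧ (sym (test-extension v S))) (split (test (extension v) S) (toℕ (c S) ≡ᵇ pat a (toℕ m)))))
          (∑-+ (allSubsets n) (⟦_⟧ ∘ hit c (extension v)) (⟦_⟧ ∘ miss c (extension v)))))
        (∑-+ (allFin n) H M))
        where
        split : ∀ a b → ⟦ a ⟧ ≡ ⟦ a ∧ b ⟧ + ⟦ a ∧ not b ⟧
        split false b     = refl
        split true  true  = refl
        split true  false = refl

      -- Adding the hits to `q` times the hits gives the factor `suc q`; the `n` choices of the
      -- vertex at position `m` turn the error of order n^(k-1) into one of order n^k.
      fitting-step : (∀ τ → Balanced c τ) →
        fitting c G a (toℕ m) * d ≤ suc q * (fitting c G a (suc (toℕ m)) * d) + 2 * n ^ k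
      fitting-step bal = begin
        fitting c G a (toℕ m) * d
          ≡⟨ cong (_* d) fitting≡hits+misses ⟩
        (∑ᶠ n H + ∑ᶠ n M) * d
          ≡⟨ trans (*-distribʳ-+ d (∑ᶠ n H) (∑ᶠ n M)) (cong (∑ᶠ n H * d +_) (*-comm (∑ᶠ n M) d)) ⟩
        ∑ᶠ n H * d + d * ∑ᶠ n M
          ≡⟨ cong (∑ᶠ n H * d +_) (sym (∑-*ˡ d (allFin n) M)) ⟩
        ∑ᶠ n H * d + ∑ᶠ n (λ v → d * M v)
          ≤⟨ +-monoʳ-≤ (∑ᶠ n H * d) (∑-mono (allFin n) (λ v → ≤-trans (≤-reflexive (*-comm d (M v))) (bal (extension v)))) ⟩
        ∑ᶠ n H * d + ∑ᶠ n (λ v → q * d * H v + 2 * n ^ suc j)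
          ≡⟨ cong (∑ᶠ n H * d +_) (trans (∑-+ (allFin n) (λ v → q * d * H v) (λ _ → 2 * n ^ suc j))
               (cong₂ _+_ (∑-*ˡ (q * d) (allFin n) H) (∑ᶠ-const n (2 * n ^ suc j)))) ⟩
        ∑ᶠ n H * d + (q * d * ∑ᶠ n H + n * (2 * n ^ suc j))
          ≡⟨ regroup (∑ᶠ n H) d q n (n ^ suc j) ⟩
        suc q * (∑ᶠ n H * d) + 2 * n ^ k
          ≡⟨ cong (λ s → suc q * (s * d) + 2 * n ^ k) (sym fitting-suc≡hits) ⟩
        suc q * (fitting c G a (suc (toℕ m)) * d) + 2 * n ^ k ∎
        where
        open ≤-Reasoning
        regroup : ∀ h d q n r → h * d + (q * d * h + n * (2 * r)) ≡ suc q * (h * d) + 2 * (n * r)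
        regroup = solve-∀

    fitting-iterate : ∀ c → (∀ τ → Balanced c τ) → ∀ G a m → m ≤ k →
      fitting c G a 0 * d ≤ suc q ^ m * (fitting c G a m * d) + m * suc q ^ m * (2 * n ^ k)
    fitting-iterate c bal G a zero    _   = ≤-reflexive (unit (fitting c G a 0 * d))
      where
      unit : ∀ u → u ≡ 1 * u + 0
      unit = solve-∀
    fitting-iterate c bal G a (suc m) m<k = begin
      fitting c G a 0 * d
        ≤⟨ fitting-iterate c bal G a m (<⇒≤ m<k) ⟩
      Q * (fitting c G a m * d) + m * Q * r
        ≤⟨ +-monoˡ-≤ _ (*-monoʳ-≤ Q step) ⟩
      Q * (suc q * u + r) + m * Q * r
        ≡⟨ regroup₁ Q q u r m ⟩
      suc q * Q * u + (suc m * Q) * r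
        ≤⟨ +-monoʳ-≤ (suc q * Q * u) (*-monoˡ-≤ r (*-monoʳ-≤ (suc m) (m≤m+n Q (q * Q)))) ⟩
      suc q * Q * u + suc m * (suc q * Q) * r ∎
      where
      open ≤-Reasoning
      Q = suc q ^ m
      r = 2 * n ^ k
      u = fitting c G a (suc m) * d
      step : fitting c G a m * d ≤ suc q * u + r
      step = subst (λ m → fitting c G a m * d ≤ suc q * (fitting c G a (suc m) * d) + r)
        (toℕ-fromℕ< m<k) (fitting-step c G a (fromℕ< m<k) bal)
      regroup₁ : ∀ Q q u r m → Q * (suc q * u + r) + m * Q * r ≡ suc q * Q * u + (suc m * Q) * r
      regroup₁ = solve-∀

    -- The colouring precedes `G` and the pattern: density needs one hypergraph for all `G`, and the
    -- patterns are to be united in it.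
    ∃-quasirandom : ∃ λ (c : Subset n → Fin (suc q)) → ∀ G a →
      count (inK k j G) * d ≤
        suc q ^ k * (count (λ e → inK k j G e ∧ fits c (pat a) k e) * d) + k * suc q ^ k * (2 * n ^ k)
    ∃-quasirandom = c , λ G a → subst₂ (λ u w → u * d ≤ suc q ^ k * (w * d) + k * suc q ^ k * (2 * n ^ k))
      (trans (∑-cong (allSubsets n) (λ e → cong ⟦_⟧ (true-⇔⇒≡ ∧-trueˡ (λ eq → ∧-true⁺ eq (fits-zero c (pat a) e)))))
        (sym (count≡∑ (inK k j G))))
      (sym (count≡∑ (λ e → inK k j G e ∧ fits c (pat a) k e)))
      (fitting-iterate c (balanced-all c (proj₂ ∃-colouring-balanced)) G a k ≤-refl)
      where
      c : Subset n → Fin (suc q)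
      c = proj₁ ∃-colouring-balanced

-- Fractions and the density inequality

/-* : ∀ a b m n .{{_ : NonZero m}} .{{_ : NonZero n}} →
  (ℤ.+ a / m) ℚ.* (ℤ.+ b / n) ≡ _/_ (ℤ.+ (a * b)) (m * n) {{m*n≢0 m n}}
/-* a b m@(suc m-1) n@(suc n-1) = ℚ.toℚᵘ-injective (begin
  toℚᵘ ((ℤ.+ a / m) ℚ.* (ℤ.+ b / n))         ≈⟨ ℚ.toℚᵘ-homo-* (ℤ.+ a / m) (ℤ.+ b / n) ⟩
  toℚᵘ (ℤ.+ a / m) ℚᵘ.* toℚᵘ (ℤ.+ b / n)     ≈⟨ ℚᵘ.*-cong (ℚ.toℚᵘ-fromℚᵘ (mkℚᵘ (ℤ.+ a) m-1)) (ℚ.toℚᵘ-fromℚᵘ (mkℚᵘ (ℤ.+ b) n-1)) ⟩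
  mkℚᵘ (ℤ.+ a) m-1 ℚᵘ.* mkℚᵘ (ℤ.+ b) n-1     ≡⟨ cong (λ i → mkℚᵘ i (n-1 + m-1 * n)) (sym (ℤ.pos-* a b)) ⟩
  mkℚᵘ (ℤ.+ (a * b)) (n-1 + m-1 * n)       ≈⟨ ℚᵘ.≃-sym (ℚ.toℚᵘ-fromℚᵘ (mkℚᵘ (ℤ.+ (a * b)) (n-1 + m-1 * n))) ⟩
  toℚᵘ (ℤ.+ (a * b) / (m * n))             ∎)
  where open ℚᵘ.≃-Reasoning

/-+ : ∀ a b m n .{{_ : NonZero m}} .{{_ : NonZero n}} →
  (ℤ.+ a / m) ℚ.+ (ℤ.+ b / n) ≡ _/_ (ℤ.+ (a * n + b * m)) (m * n) {{m*n≢0 m n}}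
/-+ a b m@(suc m-1) n@(suc n-1) = ℚ.toℚᵘ-injective (begin
  toℚᵘ ((ℤ.+ a / m) ℚ.+ (ℤ.+ b / n))         ≈⟨ ℚ.toℚᵘ-homo-+ (ℤ.+ a / m) (ℤ.+ b / n) ⟩
  toℚᵘ (ℤ.+ a / m) ℚᵘ.+ toℚᵘ (ℤ.+ b / n)     ≈⟨ ℚᵘ.+-cong (ℚ.toℚᵘ-fromℚᵘ (mkℚᵘ (ℤ.+ a) m-1)) (ℚ.toℚᵘ-fromℚᵘ (mkℚᵘ (ℤ.+ b) n-1)) ⟩
  mkℚᵘ (ℤ.+ a) m-1 ℚᵘ.+ mkℚᵘ (ℤ.+ b) n-1     ≡⟨ cong (λ i → mkℚᵘ i (n-1 + m-1 * n))
                                              (cong₂ ℤ._+_ (sym (ℤ.pos-* a n)) (sym (ℤ.pos-* b m))) ⟩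
  mkℚᵘ (ℤ.+ (a * n + b * m)) (n-1 + m-1 * n) ≈⟨ ℚᵘ.≃-sym (ℚ.toℚᵘ-fromℚᵘ (mkℚᵘ (ℤ.+ (a * n + b * m)) (n-1 + m-1 * n))) ⟩
  toℚᵘ (ℤ.+ (a * n + b * m) / (m * n))     ∎)
  where open ℚᵘ.≃-Reasoning

/-≤ : ∀ a b m n .{{_ : NonZero m}} .{{_ : NonZero n}} → a * n ≤ b * m → (ℤ.+ a / m) ℚ.≤ (ℤ.+ b / n)
/-≤ a b m@(suc m-1) n@(suc n-1) an≤bm = ℚ.toℚᵘ-cancel-≤ (begin
  toℚᵘ (ℤ.+ a / m)   ≃⟨ ℚ.toℚᵘ-fromℚᵘ (mkℚᵘ (ℤ.+ a) m-1) ⟩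
  mkℚᵘ (ℤ.+ a) m-1   ≤⟨ *≤* (subst₂ ℤ._≤_ (ℤ.pos-* a n) (ℤ.pos-* b m) (ℤ.+≤+ an≤bm)) ⟩
  mkℚᵘ (ℤ.+ b) n-1   ≃⟨ ℚᵘ.≃-sym (ℚ.toℚᵘ-fromℚᵘ (mkℚᵘ (ℤ.+ b) n-1)) ⟩
  toℚᵘ (ℤ.+ b / n)   ∎)
  where open ℚᵘ.≤-Reasoning

/-< : ∀ a b m n .{{_ : NonZero m}} .{{_ : NonZero n}} → a * n < b * m → (ℤ.+ a / m) ℚ.< (ℤ.+ b / n)
/-< a b m@(suc m-1) n@(suc n-1) an<bm = ℚ.toℚᵘ-cancel-< (begin-strict
  toℚᵘ (ℤ.+ a / m)   ≃⟨ ℚ.toℚᵘ-fromℚᵘ (mkℚᵘ (ℤ.+ a) m-1) ⟩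
  mkℚᵘ (ℤ.+ a) m-1   <⟨ *<* (subst₂ ℤ._<_ (ℤ.pos-* a n) (ℤ.pos-* b m) (ℤ.+<+ an<bm)) ⟩
  mkℚᵘ (ℤ.+ b) n-1   ≃⟨ ℚᵘ.≃-sym (ℚ.toℚᵘ-fromℚᵘ (mkℚᵘ (ℤ.+ b) n-1)) ⟩
  toℚᵘ (ℤ.+ b / n)   ∎)
  where open ℚᵘ.≤-Reasoning

1/↧≤ : ∀ μ → 0ℚ ℚ.< μ → ∃ λ den-1 → (ℤ.+ 1 / suc den-1) ℚ.≤ μ
1/↧≤ μ@(mkℚ ℤ.+[1+ a ] den-1 _) _ = den-1 , ℚ.toℚᵘ-cancel-≤ (begin
  toℚᵘ (ℤ.+ 1 / suc den-1)    ≃⟨ ℚ.toℚᵘ-fromℚᵘ (mkℚᵘ (ℤ.+ 1) den-1) ⟩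
  mkℚᵘ (ℤ.+ 1) den-1          ≤⟨ *≤* (ℤ.+≤+ (*-monoˡ-≤ (suc den-1) (s≤s (z≤n {a})))) ⟩
  mkℚᵘ ℤ.+[1+ a ] den-1       ∎)
  where open ℚᵘ.≤-Reasoning
1/↧≤ (mkℚ (ℤ.+ 0) _ _)        (ℚ.*<* (ℤ.+<+ ()))
1/↧≤ (mkℚ (ℤ.-[1+ _ ]) _ _) (ℚ.*<* ())

-- The last hypothesis is the density inequality for the extreme values `c / Q` and `1 / den`,
-- multiplied by `Q * den`.
density-≤ : ∀ (d μ : ℚ) c Q K N X den .{{_ : NonZero Q}} .{{_ : NonZero den}} →
  d ℚ.≤ (ℤ.+ c / Q) → (ℤ.+ 1 / den) ℚ.≤ μ → c * den * K ≤ Q * den * X + Q * N →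
  d ℚ.* ℕ→ℚ K ℚ.- μ ℚ.* ℕ→ℚ N ℚ.≤ ℕ→ℚ X
density-≤ d μ c Q K N X den d≤ ≤μ h = begin
  d ℚ.* ℕ→ℚ K ℚ.- μ ℚ.* ℕ→ℚ N
    ≤⟨ ℚ.+-mono-≤ (ℚ.*-monoʳ-≤-nonNeg (ℕ→ℚ K) {{nonNeg K}} d≤)
         (ℚ.neg-antimono-≤ (ℚ.*-monoʳ-≤-nonNeg (ℕ→ℚ N) {{nonNeg N}} ≤μ)) ⟩
  r ℚ.- u
    ≤⟨ ℚ.+-monoˡ-≤ (ℚ.- u) r≤ ⟩
  (ℕ→ℚ X ℚ.+ u) ℚ.- u
    ≡⟨ trans (ℚ.+-assoc (ℕ→ℚ X) u (ℚ.- u)) (trans (cong (ℕ→ℚ X ℚ.+_) (ℚ.+-inverseʳ u)) (ℚ.+-identityʳ (ℕ→ℚ X))) ⟩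
  ℕ→ℚ X ∎
  where
  open ℚ.≤-Reasoning
  nonNeg : ∀ m → ℚ.NonNegative (ℕ→ℚ m)
  nonNeg m = ℚ.nonNegative (/-≤ 0 m 1 1 z≤n)
  r u : ℚ
  r = (ℤ.+ c / Q) ℚ.* ℕ→ℚ K
  u = (ℤ.+ 1 / den) ℚ.* ℕ→ℚ N
  instance
    _ = m*n≢0 Q 1
    _ = m*n≢0 den 1
    _ = m*n≢0 1 (den * 1)
  regroupˡ : ∀ c den K → c * K * (1 * (den * 1)) ≡ c * den * K
  regroupˡ = solve-∀
  regroupʳ : ∀ Q den X N → Q * den * X + Q * N ≡ (X * (den * 1) + 1 * N * 1) * (Q * 1)
  regroupʳ = solve-∀
  r≤ : r ℚ.≤ ℕ→ℚ X ℚ.+ u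
  r≤ = subst₂ ℚ._≤_ (sym (/-* c K Q 1))
    (sym (trans (cong (ℕ→ℚ X ℚ.+_) (/-* 1 N den 1)) (/-+ X (1 * N) 1 (den * 1))))
    (/-≤ (c * K) (X * (den * 1) + 1 * N * 1) (Q * 1) (1 * (den * 1))
      (subst₂ _≤_ (sym (regroupˡ c den K)) (regroupʳ Q den X N) h))

-- Comparison of the two constants

-- With t = i / k this is (1 + 1/k)^i ≤ 1 + t + t² for t ≤ 1; at t = 1 it gives (1 + 1/k)^k < 3.
compound-interest : ∀ k i → i < k →
  suc k ^ suc i * (k * k) < k ^ suc i * (k * k + suc i * k + suc i * suc i)
compound-interest-≤ : ∀ k i → i ≤ k → suc k ^ i * (k * k) ≤ k ^ i * (k * k + i * k + i * i)

compound-interest k i i<k = begin-strict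
  suc k ^ suc i * (k * k)
    ≡⟨ *-assoc (suc k) (suc k ^ i) (k * k) ⟩
  suc k * (suc k ^ i * (k * k))
    ≤⟨ *-monoʳ-≤ (suc k) (compound-interest-≤ k i (<⇒≤ i<k)) ⟩
  suc k * (u * (k * k + i * k + i * i))
    ≡⟨ regroup₁ k u i ⟩
  u * (k * (k * k + i * k + i * i) + (k * k + i * k)) + u * i * i
    ≤⟨ +-monoʳ-≤ _ (*-monoʳ-≤ (u * i) (<⇒≤ i<k)) ⟩
  u * (k * (k * k + i * k + i * i) + (k * k + i * k)) + u * i * k
    -- The square of `suc i` leaves a spare `u * k`, which makes the inequality strict.
    <⟨ m<m+n _ (*-mono-≤ (>-nonZero⁻¹ u {{m^n≢0 k i}}) (>-nonZero⁻¹ k)) ⟩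
  u * (k * (k * k + i * k + i * i) + (k * k + i * k)) + u * i * k + u * k
    ≡⟨ regroup₂ k u i ⟩
  k ^ suc i * (k * k + suc i * k + suc i * suc i) ∎
  where
  open ≤-Reasoning
  u = k ^ i
  instance
    k≢0 : NonZero k
    k≢0 = >-nonZero (≤-<-trans z≤n i<k)
  regroup₁ : ∀ k u i → suc k * (u * (k * k + i * k + i * i)) ≡
    u * (k * (k * k + i * k + i * i) + (k * k + i * k)) + u * i * i
  regroup₁ = solve-∀
  regroup₂ : ∀ k u i → u * (k * (k * k + i * k + i * i) + (k * k + i * k)) + u * i * k + u * k ≡
    k * u * (k * k + suc i * k + suc i * suc i)
  regroup₂ = solve-∀

compound-interest-≤ k zero    _   = ≤-reflexive (regroup (k * k))
  where
  regroup : ∀ u → 1 * u ≡ 1 * (u + 0 + 0)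
  regroup = solve-∀
compound-interest-≤ k (suc i) i<k = <⇒≤ (compound-interest k i i<k)

[1+k]^k<3k^k : ∀ i → let k = suc i in suc k ^ k < 3 * k ^ k
[1+k]^k<3k^k i = *-cancelʳ-< (k * k) _ _ (<-≤-trans (compound-interest k i ≤-refl) (≤-reflexive (regroup (k ^ k) k)))
  where
  k = suc i
  regroup : ∀ u k → u * (k * k + k * k + k * k) ≡ 3 * u * (k * k)
  regroup = solve-∀

invPow<threeOver : ∀ i → invPow (suc i) ℚ.< threeOver (suc i)
invPow<threeOver i = /-< 1 3 (k ^ k) (suc k ^ k) {{m^n≢0 k k}} {{m^n≢0 (suc k) k}}
  (subst (_< 3 * k ^ k) (sym (*-identityˡ (suc k ^ k))) ([1+k]^k<3k^k i))
  where k = suc i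

-- The number of tests against the size of a deviation

n≤2^n : ∀ n → n ≤ 2 ^ n
n≤2^n zero    = z≤n
n≤2^n (suc n) = ≤-trans (+-mono-≤ (m^n>0 2 n) (n≤2^n n)) (≤-reflexive (cong (_+_ (2 ^ n)) (sym (+-identityʳ (2 ^ n)))))

m≤2^[m*n] : ∀ m n .{{_ : NonZero n}} → m ≤ 2 ^ (m * n)
m≤2^[m*n] m n = ≤-trans (n≤2^n m) (^-monoʳ-≤ 2 (m≤m*n m n))

-- Each factor on the left is at most a power of 2 whose exponent is a constant times `N`. With `N`
-- as n^(k-2), the exponent `n′ * N` is of order n^(k-1) and wins once `n′` exceeds the sum of these
-- constants times `d`.
exponential-beats : ∀ C b d N n′ n .{{_ : NonZero N}} → n ≤ N → (C + 1 + b) * d < n′ →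
  (C * (n * b ^ N)) ^ d < 2 ^ (n′ * N)
exponential-beats C b d N n′ n n≤N large = begin-strict
  (C * (n * b ^ N)) ^ d
    ≤⟨ ^-monoˡ-≤ d (*-mono-≤ (m≤2^[m*n] C N) (*-mono-≤ (≤-trans (n≤2^n n) (^-monoʳ-≤ 2 n≤N)) (^-monoˡ-≤ N (n≤2^n b)))) ⟩
  (2 ^ (C * N) * (2 ^ N * (2 ^ b) ^ N)) ^ d
    ≡⟨ cong (_^ d) (trans (cong (λ u → 2 ^ (C * N) * (2 ^ N * u)) (^-*-assoc 2 b N))
         (sym (trans (^-distribˡ-+-* 2 (C * N) (N + b * N)) (cong (2 ^ (C * N) *_) (^-distribˡ-+-* 2 N (b * N)))))) ⟩
  (2 ^ (C * N + (N + b * N))) ^ d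
    ≡⟨ trans (^-*-assoc 2 (C * N + (N + b * N)) d) (cong (2 ^_) (regroup C N b d)) ⟩
  2 ^ ((C + 1 + b) * d * N)
    <⟨ ^-monoʳ-< 2 (s≤s (s≤s z≤n)) (*-monoˡ-< N large) ⟩
  2 ^ (n′ * N) ∎
  where
  open ≤-Reasoning
  regroup : ∀ C N b d → (C * N + (N + b * N)) * d ≡ (C + 1 + b) * d * N
  regroup = solve-∀

-- The three patterns and their graph

-- The colours at positions (i , j) are (x , y), (z , x) and (z , y) for x = i, y = j, z = k.
pattern₃ : (k i j : ℕ) → Fin 3 → ℕ → ℕ
pattern₃ k i j fzero               ℓ = ℓ
pattern₃ k i j (fsuc fzero)        ℓ = if ℓ ≡ᵇ i then k else if ℓ ≡ᵇ j then i else ℓ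
pattern₃ k i j (fsuc (fsuc fzero)) ℓ = if ℓ ≡ᵇ i then k else ℓ

pattern₃< : ∀ k i j → i < k → j < k → ∀ a ℓ → ℓ < k → pattern₃ k i j a ℓ < suc k
pattern₃< k i j i<k j<k fzero               ℓ ℓ<k = m<n⇒m<1+n ℓ<k
pattern₃< k i j i<k j<k (fsuc fzero)        ℓ ℓ<k with ℓ ≡ᵇ i | ℓ ≡ᵇ j
... | true  | _     = n<1+n k
... | false | true  = m<n⇒m<1+n i<k
... | false | false = m<n⇒m<1+n ℓ<k
pattern₃< k i j i<k j<k (fsuc (fsuc fzero)) ℓ ℓ<k with ℓ ≡ᵇ i
... | true  = n<1+n k
... | false = m<n⇒m<1+n ℓ<k

≡ᵇ-refl : ∀ m → (m ≡ᵇ m) ≡ true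
≡ᵇ-refl m = ≡⇒≡ᵇ-true {m} refl

≢⇒≡ᵇ-false : ∀ {m n} → m ≢ n → (m ≡ᵇ n) ≡ false
≢⇒≡ᵇ-false {m} {n} m≢n with m ≡ᵇ n in eq
... | true  = ⊥-elim (m≢n (≡ᵇ-true⇒≡ m n eq))
... | false = refl

fits-agree : ∀ {n q} (c : Subset n → Fin q) {k} P P′ e → ∣ e ∣ ≡ k →
  fits c P k e ≡ true → fits c P′ k e ≡ true → ∀ ℓ → ℓ < k → P ℓ ≡ P′ ℓ
fits-agree c P P′ e refl fP fP′ ℓ ℓ<k with ∃-pos e ℓ ℓ<k
... | v , v∈e , refl = trans (sym (fits⁻ c P _ e fP v v∈e ℓ<k)) (fits⁻ c P′ _ e fP′ v v∈e ℓ<k)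

graph : ∀ {n} (k i j : ℕ) → (Subset n → Fin (suc k)) → Subset n → Bool
graph k i j c e = (∣ e ∣ ≡ᵇ k) ∧ (fits c (P fzero) k e ∨
  (fits c (P (fsuc fzero)) k e ∨ fits c (P (fsuc (fsuc fzero))) k e))
  where P = pattern₃ k i j

graph-isKGraph : ∀ {n} k i j (c : Subset n → Fin (suc k)) → IsKGraph k (graph k i j c)
graph-isKGraph k i j c e eq = ≡ᵇ-true⇒≡ ∣ e ∣ k (∧-trueˡ eq)

⟦⟧-disjoint : ∀ b s f₀ f₁ f₂ → (b ≡ true → s ≡ true) →
  (b ≡ true → f₀ ≡ true → f₁ ≡ true → ⊥) → (b ≡ true → f₀ ≡ true → f₂ ≡ true → ⊥) →
  (b ≡ true → f₁ ≡ true → f₂ ≡ true → ⊥) →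
  ⟦ b ∧ f₀ ⟧ + (⟦ b ∧ f₁ ⟧ + ⟦ b ∧ f₂ ⟧) ≤ ⟦ b ∧ (s ∧ (f₀ ∨ (f₁ ∨ f₂))) ⟧
⟦⟧-disjoint false s f₀ f₁ f₂ b⇒s d₀₁ d₀₂ d₁₂ = z≤n
⟦⟧-disjoint true  s f₀ f₁ f₂ b⇒s d₀₁ d₀₂ d₁₂ rewrite b⇒s refl with f₀ | f₁ | f₂
... | true  | true  | _     = ⊥-elim (d₀₁ refl refl refl)
... | true  | false | true  = ⊥-elim (d₀₂ refl refl refl)
... | true  | false | false = ≤-refl
... | false | true  | true  = ⊥-elim (d₁₂ refl refl refl)
... | false | true  | false = ≤-refl
... | false | false | true  = ≤-refl
... | false | false | false = z≤n

-- A `k`-set has one face at each position, so it follows at most one of three patterns that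
-- pairwise differ at `i` or at `j`. Hence their densities add up, which is the origin of the 3 in
-- the bound.
count-graph : ∀ {n} k i j → i < k → j < k → i ≢ j → (c : Subset n → Fin (suc k)) (p : Subset n → Bool) →
  (∀ e → p e ≡ true → ∣ e ∣ ≡ k) → let X = λ a → count (λ e → p e ∧ fits c (pattern₃ k i j a) k e) in
  X fzero + (X (fsuc fzero) + X (fsuc (fsuc fzero))) ≤ count (λ e → p e ∧ graph k i j c e)
count-graph {n} k i j i<k j<k i≢j c p size = begin
  X (# 0) + (X (# 1) + X (# 2))
    ≡⟨ cong₂ _+_ (count≡∑ (Y (# 0))) (cong₂ _+_ (count≡∑ (Y (# 1))) (count≡∑ (Y (# 2)))) ⟩
  ∑ˢ n (λ e → ⟦ Y (# 0) e ⟧) + (∑ˢ n (λ e → ⟦ Y (# 1) e ⟧) + ∑ˢ n (λ e → ⟦ Y (# 2) e ⟧))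
    ≡⟨ sym (trans (∑-+ (allSubsets n) (λ e → ⟦ Y (# 0) e ⟧) (λ e → ⟦ Y (# 1) e ⟧ + ⟦ Y (# 2) e ⟧))
         (cong (∑ˢ n (λ e → ⟦ Y (# 0) e ⟧) +_) (∑-+ (allSubsets n) (λ e → ⟦ Y (# 1) e ⟧) (λ e → ⟦ Y (# 2) e ⟧)))) ⟩
  ∑ˢ n (λ e → ⟦ Y (# 0) e ⟧ + (⟦ Y (# 1) e ⟧ + ⟦ Y (# 2) e ⟧))
    ≤⟨ ∑-mono (allSubsets n) (λ e → ⟦⟧-disjoint (p e) (∣ e ∣ ≡ᵇ k) _ _ _
         (λ pe → ≡⇒≡ᵇ-true (size e pe)) (d₀₁ e) (d₀₂ e) (d₁₂ e)) ⟩
  ∑ˢ n (λ e → ⟦ p e ∧ graph k i j c e ⟧)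
    ≡⟨ sym (count≡∑ (λ e → p e ∧ graph k i j c e)) ⟩
  count (λ e → p e ∧ graph k i j c e) ∎
  where
  open ≤-Reasoning
  P = pattern₃ k i j
  Y : Fin 3 → Subset n → Bool
  Y a e = p e ∧ fits c (P a) k e
  X : Fin 3 → ℕ
  X a = count (Y a)
  clash : ∀ a b ℓ → ℓ < k → P a ℓ ≢ P b ℓ → ∀ e → p e ≡ true →
    fits c (P a) k e ≡ true → fits c (P b) k e ≡ true → ⊥
  clash a b ℓ ℓ<k P≢ e pe fa fb = P≢ (fits-agree c (P a) (P b) e (size e pe) fa fb ℓ ℓ<k)
  i≢k : i ≢ k
  i≢k = <⇒≢ i<k
  d₀₁ = clash (# 0) (# 1) i i<k (subst (λ b → i ≢ (if b then k else if i ≡ᵇ j then i else i)) (sym (≡ᵇ-refl i)) i≢k)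
  d₀₂ = clash (# 0) (# 2) i i<k (subst (λ b → i ≢ (if b then k else i)) (sym (≡ᵇ-refl i)) i≢k)
  d₁₂ = clash (# 1) (# 2) j j<k
    (subst₂ (λ b b′ → (if b then k else if b′ then i else j) ≢ (if b then k else j))
      (sym (≢⇒≡ᵇ-false (≢-sym i≢j))) (sym (≡ᵇ-refl j)) i≢j)

-- Choice of the parameters

∃-dense : ∀ j′ .{{_ : NonZero j′}} → let k = suc (suc j′) in ∀ i j → i < k → j < k → i ≢ j →
  ∀ d → d ℚ.< threeOver k → ∀ μ → 0ℚ ℚ.< μ → ∀ n₀ →
  ∃ λ n → n₀ ≤ n × Σ (Subset n → Fin (suc k)) λ c → Dense k (graph k i j c) d μ j′
∃-dense j′ i j i<k j<k i≢j d d< μ μ>0 n₀ = n , n₀≤n , c , dense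
  where
  k = suc (suc j′)
  den-1 = proj₁ (1/↧≤ μ μ>0)
  den = suc den-1
  -- The three patterns lose `k * Q * (2 * n ^ k)` each with `Q = suc k ^ k`, together `6 * k` times
  -- `Q * n ^ k`; the factor `6 * k` cancels this, and `den` brings the error below `μ`.
  D = 6 * k * den
  p = k * D
  -- The form that `drift` requires; it also exceeds `k`, so that the subtraction for `x` is exact.
  z = p * p + p
  x = z ∸ k
  b = 2 * suc k
  -- The first summand is the threshold of `exponential-beats` for `3 * k` pairs of pattern and
  -- position; the second makes `n` at least `n₀`.
  n′ = suc ((3 * k + 1 + b) * D) + n₀
  -- A multiple of `z`, so that `z * y` is exactly n^(k-1) and no rounding occurs.
  n = z * n′
  N = n ^ j′
  y = n′ * N
  k≤z : k ≤ z
  k≤z = ≤-trans (m≤m*n k D) (m≤n+m p (p * p))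
  z≡ : x + k ≡ z
  z≡ = m∸n+n≡m k≤z
  instance
    z≢0 : NonZero z
    z≢0 = >-nonZero (≤-trans (s≤s z≤n) k≤z)
    n≢0 : NonZero n
    n≢0 = m*n≢0 z n′
    N≢0 : NonZero N
    N≢0 = m^n≢0 n j′
    x+k≢0 : NonZero (x + k)
    x+k≢0 = subst NonZero (sym z≡) z≢0
    Q≢0 : NonZero (suc k ^ k)
    Q≢0 = m^n≢0 (suc k) k
  n₀≤n : n₀ ≤ n
  n₀≤n = ≤-trans (m≤n+m n₀ (suc ((3 * k + 1 + b) * D))) (m≤n*m n′ z)
  -- Here `k ≥ 3` enters: the factor `n` for the vertex of a test is dominated by n^(k-2) because
  -- `j′ ≥ 1`.
  n≤N : n ≤ N
  n≤N = ≤-trans (≤-reflexive (sym (^-identityʳ n))) (^-monoʳ-≤ n (>-nonZero⁻¹ j′))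
  few : (3 * k * (n * b ^ N)) ^ D < 2 ^ y
  few = exponential-beats (3 * k) b D N n′ n n≤N (m≤m+n _ n₀)
  zy≡ : (x + k) * y ≡ n ^ suc j′
  zy≡ = trans (cong (_* y) z≡) (sym (*-assoc z n′ N))
  open Quasirandom j′ k 3 n (pattern₃ k i j) (pattern₃< k i j i<k j<k) using (∃-quasirandom)
  quasirandom = ∃-quasirandom x D y z≡ few zy≡
  c = proj₁ quasirandom
  regroupˡ : ∀ den K k → 3 * den * K * (6 * k) ≡ K * (6 * k * den) + (K * (6 * k * den) + K * (6 * k * den))
  regroupˡ = solve-∀
  regroupʳ : ∀ Q k den X₀ X₁ X₂ N →
    (Q * (X₀ * (6 * k * den)) + k * Q * (2 * N)) +
      ((Q * (X₁ * (6 * k * den)) + k * Q * (2 * N)) + (Q * (X₂ * (6 * k * den)) + k * Q * (2 * N))) ≡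
    (Q * den * (X₀ + (X₁ + X₂)) + Q * N) * (6 * k)
  regroupʳ = solve-∀
  dense : Dense k (graph k i j c) d μ j′
  dense G = density-≤ d μ 3 Q K (n ^ k) X den (ℚ.<⇒≤ d<) (proj₂ (1/↧≤ μ μ>0))
    (*-cancelʳ-≤ _ _ (6 * k) (begin
      3 * den * K * (6 * k)
        ≡⟨ regroupˡ den K k ⟩
      K * D + (K * D + K * D)
        ≤⟨ +-mono-≤ (bound fzero) (+-mono-≤ (bound (fsuc fzero)) (bound (fsuc (fsuc fzero)))) ⟩
      (Q * (Xₐ fzero * D) + k * Q * (2 * n ^ k)) +
        ((Q * (Xₐ (fsuc fzero) * D) + k * Q * (2 * n ^ k)) + (Q * (Xₐ (fsuc (fsuc fzero)) * D) + k * Q * (2 * n ^ k)))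
        ≡⟨ regroupʳ Q k den (Xₐ fzero) (Xₐ (fsuc fzero)) (Xₐ (fsuc (fsuc fzero))) (n ^ k) ⟩
      (Q * den * (Xₐ fzero + (Xₐ (fsuc fzero) + Xₐ (fsuc (fsuc fzero)))) + Q * n ^ k) * (6 * k)
        ≤⟨ *-monoˡ-≤ (6 * k) (+-monoˡ-≤ (Q * n ^ k) (*-monoʳ-≤ (Q * den)
             (count-graph k i j i<k j<k i≢j c (inK k j′ G) (inK-size k j′ G)))) ⟩
      (Q * den * X + Q * n ^ k) * (6 * k) ∎))
    where
    open ≤-Reasoning
    Q K X : ℕ
    Q = suc k ^ k
    K = count (inK k j′ G)
    X = count (λ e → inK k j′ G e ∧ graph k i j c e)
    Xₐ : Fin 3 → ℕ
    Xₐ a = count (λ e → inK k j′ G e ∧ fits c (pattern₃ k i j a) k e)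
    bound : ∀ a → K * D ≤ Q * (Xₐ a * D) + k * Q * (2 * n ^ k)
    bound = proj₂ quasirandom G

-- Images of sets under an embedding

⌊⌋-true : (A? : Dec A) → A → ⌊ A? ⌋ ≡ true
⌊⌋-true A? a = trans (isYes≗does A?) (dec-true A? a)

⌊⌋-false : (A? : Dec A) → ¬ A → ⌊ A? ⌋ ≡ false
⌊⌋-false A? ¬a = trans (isYes≗does A?) (dec-false A? ¬a)

∑-mono-< : {xs : List A} {g h : A → ℕ} {x : A} → (∀ y → g y ≤ h y) → x ∈ xs → g x < h x → ∑ xs g < ∑ xs h
∑-mono-< {xs = _ ∷ xs} g≤h (here refl) gx<hx = +-mono-<-≤ gx<hx (∑-mono xs g≤h)
∑-mono-< {xs = y ∷ xs} g≤h (there x∈)  gx<hx = +-mono-≤-< (g≤h y) (∑-mono-< g≤h x∈ gx<hx)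

∑ᶠ-zero : ∀ n {g : Fin n → ℕ} → (∀ y → g y ≡ 0) → ∑ᶠ n g ≡ 0
∑ᶠ-zero n g≡0 = trans (∑-cong (allFin n) g≡0) (trans (∑ᶠ-const n 0) (*-zeroʳ n))

∑ᶠ-single : ∀ n (x : Fin n) {g : Fin n → ℕ} → (∀ y → y ≢ x → g y ≡ 0) → ∑ᶠ n g ≡ g x
∑ᶠ-single (suc n) fzero {g} off = trans (∑ᶠ-suc n g)
  (trans (cong (g fzero +_) (∑ᶠ-zero n (λ y → off (fsuc y) (λ ())))) (+-identityʳ (g fzero)))
∑ᶠ-single (suc n) (fsuc x) {g} off = trans (∑ᶠ-suc n g)
  (trans (cong (_+ ∑ᶠ n (g ∘ fsuc)) (off fzero (λ ()))) (∑ᶠ-single n x (λ y y≢x → off (fsuc y) (λ { refl → y≢x refl }))))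

pos≡∑ : ∀ {n} (e : Subset n) v → pos e v ≡ ∑ᶠ n (λ u → ⟦ lookup e u ∧ (toℕ u <ᵇ toℕ v) ⟧)
pos≡∑ {suc n} (b ∷ e) fzero = sym (∑ᶠ-zero (suc n) (λ u → none (lookup (b ∷ e) u)))
  where
  none : ∀ a → ⟦ a ∧ false ⟧ ≡ 0
  none true  = refl
  none false = refl
pos≡∑ {suc n} (b ∷ e) (fsuc v) = trans (cong₂ _+_ (first b) (pos≡∑ e v))
  (sym (∑ᶠ-suc n (λ u → ⟦ lookup (b ∷ e) u ∧ (toℕ u <ᵇ toℕ (fsuc v)) ⟧)))
  where
  first : ∀ b → ⟦ b ⟧ ≡ ⟦ b ∧ true ⟧
  first true  = refl
  first false = refl

any⁺ : (p : A → Bool) {xs : List A} {x : A} → x ∈ xs → p x ≡ true → any p xs ≡ true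
any⁺ p {xs = y ∷ xs} (here refl) px rewrite px = refl
any⁺ p {xs = y ∷ xs} (there x∈)  px with p y
... | true  = refl
... | false = any⁺ p x∈ px

any⁻ : (p : A → Bool) (xs : List A) → any p xs ≡ true → ∃ λ x → p x ≡ true
any⁻ p (x ∷ xs) eq with p x in px
... | true  = x , px
... | false = any⁻ p xs eq

lookup-ext : ∀ {n} {S R : Subset n} → (∀ v → lookup S v ≡ lookup R v) → S ≡ R
lookup-ext {S = S} {R} h = trans (sym (tabulate∘lookup S)) (trans (tabulate-cong h) (tabulate∘lookup R))

∈-image⁺ : ∀ {f n} (φ : Fin f → Fin n) e x → lookup e x ≡ true → lookup (image φ e) (φ x) ≡ true
∈-image⁺ φ e x x∈e = trans (lookup∘tabulate _ (φ x))
  (any⁺ (λ u → lookup e u ∧ ⌊ φ u ≟ᶠ φ x ⌋) (∈-allFin x) (∧-true⁺ x∈e (⌊⌋-true (φ x ≟ᶠ φ x) refl)))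

∈-image⁻ : ∀ {f n} (φ : Fin f → Fin n) e y → lookup (image φ e) y ≡ true → ∃ λ x → lookup e x ≡ true × φ x ≡ y
∈-image⁻ {f} φ e y eq with any⁻ (λ u → lookup e u ∧ ⌊ φ u ≟ᶠ y ⌋) (allFin f) (trans (sym (lookup∘tabulate _ y)) eq)
... | x , both with φ x ≟ᶠ y
... | yes φx≡y = x , ∧-trueˡ both , φx≡y
... | no  _    with () ← ∧-trueʳ {lookup e x} both

image-cong : ∀ {f n} {φ ψ : Fin f → Fin n} → (∀ x → φ x ≡ ψ x) → ∀ e → image φ e ≡ image ψ e
image-cong {φ = φ} {ψ} φ≗ψ e = lookup-ext λ y → true-⇔⇒≡ (to φ ψ φ≗ψ y) (to ψ φ (sym ∘ φ≗ψ) y)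
  where
  to : ∀ φ ψ → (∀ x → φ x ≡ ψ x) → ∀ y → lookup (image φ e) y ≡ true → lookup (image ψ e) y ≡ true
  to φ ψ φ≗ψ y eq with ∈-image⁻ φ e y eq
  ... | x , x∈e , refl = subst (λ u → lookup (image ψ e) u ≡ true) (sym (φ≗ψ x)) (∈-image⁺ ψ e x x∈e)

∖≡delete : ∀ {n} (e : Subset n) v → (e ∖ₛ v) ≡ delete v e
∖≡delete (true ∷ e)  fzero    = cong (false ∷_) (p─⊥≡p e)
∖≡delete (false ∷ e) fzero    = cong (false ∷_) (p─⊥≡p e)
∖≡delete (true ∷ e)  (fsuc v) = cong (true ∷_) (∖≡delete e v)
∖≡delete (false ∷ e) (fsuc v) = cong (false ∷_) (∖≡delete e v)

image-delete : ∀ {f n} (φ : Fin f → Fin n) → Injective _≡_ _≡_ φ → ∀ e v →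
  image φ (delete v e) ≡ delete (φ v) (image φ e)
image-delete φ inj e v = lookup-ext λ y → true-⇔⇒≡ (to y) (from y)
  where
  gone : ∀ {n} (w : Fin n) S → lookup (delete w S) w ≢ true
  gone w S eq with () ← trans (sym (lookup∘updateAt w S)) eq
  to : ∀ y → lookup (image φ (delete v e)) y ≡ true → lookup (delete (φ v) (image φ e)) y ≡ true
  to y eq with ∈-image⁻ φ (delete v e) y eq
  ... | x , x∈ , refl = trans (lookup-delete-≢ (φ x) (φ v) (image φ e) (x≢v ∘ inj))
      (∈-image⁺ φ e x (trans (sym (lookup-delete-≢ x v e x≢v)) x∈))
    where
    x≢v : x ≢ v
    x≢v refl = gone x e x∈
  from : ∀ y → lookup (delete (φ v) (image φ e)) y ≡ true → lookup (image φ (delete v e)) y ≡ true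
  from y eq with y ≟ᶠ φ v
  ... | yes refl = ⊥-elim (gone (φ v) (image φ e) eq)
  ... | no y≢φv with ∈-image⁻ φ e y (trans (sym (lookup-delete-≢ y (φ v) (image φ e) y≢φv)) eq)
  ... | x , x∈e , refl = ∈-image⁺ φ (delete v e) x (trans (lookup-delete-≢ x v e (λ { refl → y≢φv refl })) x∈e)

∑-image : ∀ {f n} (φ : Fin f → Fin n) → Injective _≡_ _≡_ φ → ∀ e (g : Fin n → ℕ) →
  ∑ᶠ n (λ y → ⟦ lookup (image φ e) y ⟧ * g y) ≡ ∑ᶠ f (λ x → ⟦ lookup e x ⟧ * g (φ x))
∑-image {f} {n} φ inj e g = begin
  ∑ᶠ n (λ y → ⟦ lookup (image φ e) y ⟧ * g y)
    ≡⟨ ∑-cong (allFin n) (λ y → expand y (lookup (image φ e) y) refl) ⟩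
  ∑ᶠ n (λ y → ∑ᶠ f (λ x → term x y))
    ≡⟨ ∑-swap (allFin n) (allFin f) (λ y x → term x y) ⟩
  ∑ᶠ f (λ x → ∑ᶠ n (term x))
    ≡⟨ ∑-cong (allFin f) (λ x → trans (∑ᶠ-single n (φ x) (λ y y≢ → off x y (≢-sym y≢))) (on x)) ⟩
  ∑ᶠ f (λ x → ⟦ lookup e x ⟧ * g (φ x)) ∎
  where
  open ≡-Reasoning
  term : Fin f → Fin n → ℕ
  term x y = ⟦ lookup e x ⟧ * (⟦ ⌊ φ x ≟ᶠ y ⌋ ⟧ * g y)
  off : ∀ x y → φ x ≢ y → term x y ≡ 0
  off x y φx≢y = trans (cong (λ b → ⟦ lookup e x ⟧ * (⟦ b ⟧ * g y)) (⌊⌋-false (φ x ≟ᶠ y) φx≢y)) (*-zeroʳ ⟦ lookup e x ⟧)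
  on : ∀ x → term x (φ x) ≡ ⟦ lookup e x ⟧ * g (φ x)
  on x = trans (cong (λ b → ⟦ lookup e x ⟧ * (⟦ b ⟧ * g (φ x))) (⌊⌋-true (φ x ≟ᶠ φ x) refl))
    (cong (⟦ lookup e x ⟧ *_) (*-identityˡ (g (φ x))))
  expand : ∀ y b → lookup (image φ e) y ≡ b → ⟦ b ⟧ * g y ≡ ∑ᶠ f (λ x → term x y)
  expand y true  eq with ∈-image⁻ φ e y eq
  ... | x , x∈e , refl = sym (trans (∑ᶠ-single f x (λ u u≢x → off u y (u≢x ∘ inj)))
    (trans (on x) (cong (λ b → ⟦ b ⟧ * g (φ x)) x∈e)))
  expand y false eq = sym (∑ᶠ-zero f vanish)
    where
    vanish : ∀ x → term x y ≡ 0
    vanish x with φ x ≟ᶠ y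
    ... | no _     = *-zeroʳ ⟦ lookup e x ⟧
    ... | yes refl with lookup e x in x∈e
    ... | false = refl
    ... | true  with () ← trans (sym eq) (∈-image⁺ φ e x x∈e)

-- The order that an embedding induces on `F`

module InducedOrder {f n : ℕ} (φ : Fin f → Fin n) (inj : Injective _≡_ _≡_ φ) where

  -- An ordering of `F` takes values in `Fin f`, so the order pulled back from `Fin n` is compressed
  -- to ranks among the image vertices.
  below : Fin f → ℕ
  below u = ∑ᶠ f (λ w → ⟦ toℕ (φ w) <ᵇ toℕ (φ u) ⟧)

  self : ∀ u → ⟦ toℕ (φ u) <ᵇ toℕ (φ u) ⟧ ≡ 0
  self u with toℕ (φ u) <ᵇ toℕ (φ u) in eq
  ... | true  = ⊥-elim (<-irrefl refl (<ᵇ-true⇒< (toℕ (φ u)) (toℕ (φ u)) eq))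
  ... | false = refl

  below<f : ∀ u → below u < f
  below<f u = subst (below u <_) (trans (∑ᶠ-const f 1) (*-identityʳ f))
    (∑-mono-< (λ w → ⟦⟧-mono {toℕ (φ w) <ᵇ toℕ (φ u)} {true} (λ _ → refl)) (∈-allFin u)
      (s≤s (≤-reflexive (self u))))

  rk : Fin f → Fin f
  rk u = fromℕ< (below<f u)

  toℕ-rk : ∀ u → toℕ (rk u) ≡ below u
  toℕ-rk u = toℕ-fromℕ< (below<f u)

  below-mono-≤ : ∀ {u v} → toℕ (φ u) ≤ toℕ (φ v) → below u ≤ below v
  below-mono-≤ {u} {v} u≤v = ∑-mono (allFin f) (λ w → ⟦⟧-mono {toℕ (φ w) <ᵇ toℕ (φ u)} (λ eq →
    <⇒<ᵇ-true (<-≤-trans (<ᵇ-true⇒< (toℕ (φ w)) (toℕ (φ u)) eq) u≤v)))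

  below-mono-< : ∀ {u v} → toℕ (φ u) < toℕ (φ v) → below u < below v
  below-mono-< {u} {v} u<v = ∑-mono-< (λ w → ⟦⟧-mono {toℕ (φ w) <ᵇ toℕ (φ u)} (λ eq →
    <⇒<ᵇ-true (<-trans (<ᵇ-true⇒< (toℕ (φ w)) (toℕ (φ u)) eq) u<v))) (∈-allFin u)
    (subst₂ _<_ (sym (self u)) (cong ⟦_⟧ (sym (<⇒<ᵇ-true u<v))) (s≤s z≤n))

  rk-injective : Injective _≡_ _≡_ rk
  rk-injective {u} {v} eq with <-cmp (toℕ (φ u)) (toℕ (φ v))
  ... | tri< u<v _ _ = ⊥-elim (<⇒≢ (below-mono-< u<v) (trans (sym (toℕ-rk u)) (trans (cong toℕ eq) (toℕ-rk v))))
  ... | tri≈ _ u≡v _ = inj (toℕ-injective u≡v)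
  ... | tri> _ _ v<u = ⊥-elim (<⇒≢ (below-mono-< v<u) (trans (sym (toℕ-rk v)) (trans (cong toℕ (sym eq)) (toℕ-rk u))))

  rk-<ᵇ : ∀ u v → (toℕ (rk u) <ᵇ toℕ (rk v)) ≡ (toℕ (φ u) <ᵇ toℕ (φ v))
  rk-<ᵇ u v = true-⇔⇒≡
    (λ eq → <⇒<ᵇ-true (≰⇒> (λ v≤u → <⇒≱ (<ᵇ-true⇒< (toℕ (rk u)) (toℕ (rk v)) eq)
      (subst₂ _≤_ (sym (toℕ-rk v)) (sym (toℕ-rk u)) (below-mono-≤ v≤u)))))
    (λ eq → <⇒<ᵇ-true (subst₂ _<_ (sym (toℕ-rk u)) (sym (toℕ-rk v))
      (below-mono-< (<ᵇ-true⇒< (toℕ (φ u)) (toℕ (φ v)) eq))))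

  rankIn≡pos : ∀ e v → rankIn rk e v ≡ pos (image φ e) (φ v)
  rankIn≡pos e v = begin
    rankIn rk e v
      ≡⟨ rankIn≡∑ rk e v ⟩
    ∑ᶠ f (λ u → ⟦ lookup e u ∧ (toℕ (rk u) <ᵇ toℕ (rk v)) ⟧)
      ≡⟨ ∑-cong (allFin f) (λ u → trans (cong (λ b → ⟦ lookup e u ∧ b ⟧) (rk-<ᵇ u v)) (⟦⟧-∧ (lookup e u) _)) ⟩
    ∑ᶠ f (λ u → ⟦ lookup e u ⟧ * ⟦ toℕ (φ u) <ᵇ toℕ (φ v) ⟧)
      ≡⟨ sym (∑-image φ inj e (λ y → ⟦ toℕ y <ᵇ toℕ (φ v) ⟧)) ⟩
    ∑ᶠ n (λ y → ⟦ lookup (image φ e) y ⟧ * ⟦ toℕ y <ᵇ toℕ (φ v) ⟧)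
      ≡⟨ ∑-cong (allFin n) (λ y → sym (⟦⟧-∧ (lookup (image φ e) y) _)) ⟩
    ∑ᶠ n (λ y → ⟦ lookup (image φ e) y ∧ (toℕ y <ᵇ toℕ (φ v)) ⟧)
      ≡⟨ sym (pos≡∑ (image φ e) (φ v)) ⟩
    pos (image φ e) (φ v) ∎
    where open ≡-Reasoning

-- Shared faces, decoded colours and the clause of (♠*)

∣∩∣≤ : ∀ {n} (e g : Subset n) → ∣ e ∩ g ∣ ≤ ∣ e ∣
∣∩∣≤ []          []          = z≤n
∣∩∣≤ (true ∷ e)  (true ∷ g)  = s≤s (∣∩∣≤ e g)
∣∩∣≤ (true ∷ e)  (false ∷ g) = m≤n⇒m≤1+n (∣∩∣≤ e g)
∣∩∣≤ (false ∷ e) (b ∷ g)     = ∣∩∣≤ e g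

∣∩∣≡⇒∩≡ : ∀ {n} (e g : Subset n) → ∣ e ∣ ≡ ∣ e ∩ g ∣ → e ∩ g ≡ e
∣∩∣≡⇒∩≡ []          []          eq = refl
∣∩∣≡⇒∩≡ (true ∷ e)  (true ∷ g)  eq = cong (true ∷_) (∣∩∣≡⇒∩≡ e g (suc-injective eq))
∣∩∣≡⇒∩≡ (true ∷ e)  (false ∷ g) eq = ⊥-elim (<⇒≢ (s≤s (∣∩∣≤ e g)) (sym eq))
∣∩∣≡⇒∩≡ (false ∷ e) (b ∷ g)     eq = cong (false ∷_) (∣∩∣≡⇒∩≡ e g eq)

∩-misses-one : ∀ {n} (e g : Subset n) → ∣ e ∣ ≡ suc ∣ e ∩ g ∣ → ∃ λ v →
  lookup e v ≡ true × lookup (e ∩ g) v ≡ false × (e ∩ g) ∪ ⁅ v ⁆ ≡ e × delete v e ≡ e ∩ g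
∩-misses-one (true ∷ e) (true ∷ g) eq with ∩-misses-one e g (suc-injective eq)
... | v , v∈ , v∉ , ∪≡ , del≡ = fsuc v , v∈ , v∉ , cong (true ∷_) ∪≡ , cong (true ∷_) del≡
∩-misses-one (true ∷ e) (false ∷ g) eq = fzero , refl , refl ,
  cong (true ∷_) (trans (∪-identityʳ (e ∩ g)) same) , cong (false ∷_) (sym same)
  where same = ∣∩∣≡⇒∩≡ e g (suc-injective eq)
∩-misses-one (false ∷ e) (b ∷ g) eq with ∩-misses-one e g eq
... | v , v∈ , v∉ , ∪≡ , del≡ = fsuc v , v∈ , v∉ , cong (false ∷_) ∪≡ , cong (false ∷_) del≡

-- The positions that a colour takes in the second and in the third pattern.
decode : (k i j : ℕ) → ℕ → ℕ
decode k i j m = if m ≡ᵇ k then i else if m ≡ᵇ i then j else m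

decode-other : ∀ k i j m → m ≢ k → m ≢ i → decode k i j m ≡ m
decode-other k i j m m≢k m≢i rewrite ≢⇒≡ᵇ-false m≢k | ≢⇒≡ᵇ-false m≢i = refl

decode-i : ∀ k i j → i ≢ k → decode k i j i ≡ j
decode-i k i j i≢k rewrite ≢⇒≡ᵇ-false i≢k | ≡ᵇ-refl i = refl

decode-k : ∀ k i j → decode k i j k ≡ i
decode-k k i j rewrite ≡ᵇ-refl k = refl

-- Position `i` has colour `k` in this pattern, which frees the colour `i` to signal position `j`.
decode-pattern₁ : ∀ k i j ℓ → i < k → ℓ < k → decode k i j (pattern₃ k i j (fsuc fzero) ℓ) ≡ ℓ
decode-pattern₁ k i j ℓ i<k ℓ<k with ℓ ≡ᵇ i in ℓi
... | true  = trans (decode-k k i j) (sym (≡ᵇ-true⇒≡ ℓ i ℓi))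
... | false with ℓ ≡ᵇ j in ℓj
... | true  = trans (decode-i k i j (<⇒≢ i<k)) (sym (≡ᵇ-true⇒≡ ℓ j ℓj))
... | false = decode-other k i j ℓ (<⇒≢ ℓ<k) λ { refl → contradiction (trans (sym ℓi) (≡ᵇ-refl ℓ)) λ () }

decode-pattern₂ : ∀ k i j ℓ → ℓ < k → decode k i j (pattern₃ k i j (fsuc (fsuc fzero)) ℓ) ≡ ℓ
decode-pattern₂ k i j ℓ ℓ<k with ℓ ≡ᵇ i in ℓi
... | true  = trans (decode-k k i j) (sym (≡ᵇ-true⇒≡ ℓ i ℓi))
... | false = decode-other k i j ℓ (<⇒≢ ℓ<k) λ { refl → contradiction (trans (sym ℓi) (≡ᵇ-refl ℓ)) λ () }

-- `Vanishing` asks for a class for every set, but the extra colour is not a position when colours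
-- are read directly. No face of the first part has that colour, so the default `fzero` is harmless.
clamp : ∀ k′ → ℕ → Fin (suc k′)
clamp k′ m with m <? suc k′
... | yes m<k = fromℕ< m<k
... | no  _   = fzero

toℕ-clamp : ∀ k′ m → m < suc k′ → toℕ (clamp k′ m) ≡ m
toℕ-clamp k′ m m<k with m <? suc k′
... | yes m<k′ = toℕ-fromℕ< m<k′
... | no  m≮k  = ⊥-elim (m≮k m<k)

module Embedding (k′ : ℕ) {f n : ℕ} (EF : Subset f → Bool) (isKGraph : IsKGraph (suc k′) EF)
  (i j : Fin (suc k′)) (c : Subset n → Fin (suc (suc k′)))
  (φ : Fin f → Fin n) (inj : Injective _≡_ _≡_ φ)
  (embeds : ∀ e → EF e ≡ true → graph (suc k′) (toℕ i) (toℕ j) c (image φ e) ≡ true) where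

  open InducedOrder φ inj

  k : ℕ
  k = suc k′

  P : Fin 3 → ℕ → ℕ
  P = pattern₃ k (toℕ i) (toℕ j)

  σ : Subset f → Bool
  σ e = fits c (P fzero) k (image φ e)

  E₁ E₂ : Subset f → Bool
  E₁ = part₁ EF σ
  E₂ = part₂ EF σ

  γ : Subset f → ℕ
  γ S = toℕ (c (image φ S))

  rank<k : ∀ e → EF e ≡ true → ∀ v → lookup e v ≡ true → rankIn rk e v < k
  rank<k e e∈F v v∈e = subst₂ _<_ (sym (rankIn≡pos e v))
    (≡ᵇ-true⇒≡ ∣ image φ e ∣ k (∧-trueˡ (embeds e e∈F)))
    (pos<∣∣ (image φ e) (φ v) (∈-image⁺ φ e v v∈e))

  γ-delete : ∀ p e → EF e ≡ true → fits c p k (image φ e) ≡ true → ∀ v → lookup e v ≡ true →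
    γ (delete v e) ≡ p (rankIn rk e v)
  γ-delete p e e∈F fit v v∈e = trans (cong (toℕ ∘ c) (image-delete φ inj e v))
    (trans (fits⁻ c p k (image φ e) fit (φ v) (∈-image⁺ φ e v v∈e)
        (subst (_< k) (rankIn≡pos e v) (rank<k e e∈F v v∈e)))
      (cong p (sym (rankIn≡pos e v))))

  rank₁ : ∀ e → E₁ e ≡ true → ∀ v → lookup e v ≡ true → γ (delete v e) ≡ rankIn rk e v
  rank₁ e e∈ = γ-delete (P fzero) e (∧-trueˡ e∈) (∧-trueʳ {EF e} e∈)

  -- The second and the third pattern never use one colour at two different positions, even between
  -- them. One decoding therefore serves both, and the mixture `E₂` is still vanishing.
  rank₂ : ∀ e → E₂ e ≡ true → ∀ v → lookup e v ≡ true → decode k (toℕ i) (toℕ j) (γ (delete v e)) ≡ rankIn rk e v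
  rank₂ e e∈ v v∈e = go (σ e) (fits c (P (fsuc fzero)) k (image φ e)) (fits c (P (fsuc (fsuc fzero))) k (image φ e))
    refl refl refl
    where
    e∈F : EF e ≡ true
    e∈F = ∧-trueˡ e∈
    matched : (σ e ∨ (fits c (P (fsuc fzero)) k (image φ e) ∨ fits c (P (fsuc (fsuc fzero))) k (image φ e))) ≡ true
    matched = ∧-trueʳ {∣ image φ e ∣ ≡ᵇ k} (embeds e e∈F)
    go : ∀ b₀ b₁ b₂ → σ e ≡ b₀ → fits c (P (fsuc fzero)) k (image φ e) ≡ b₁ →
      fits c (P (fsuc (fsuc fzero))) k (image φ e) ≡ b₂ →
      decode k (toℕ i) (toℕ j) (γ (delete v e)) ≡ rankIn rk e v
    go true  _     _     eq₀ _   _   with () ← trans (sym (cong not eq₀)) (∧-trueʳ {EF e} e∈)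
    go false true  _     _   eq₁ _   = trans (cong (decode k (toℕ i) (toℕ j)) (γ-delete (P (fsuc fzero)) e e∈F eq₁ v v∈e))
      (decode-pattern₁ k (toℕ i) (toℕ j) (rankIn rk e v) (toℕ<n i) (rank<k e e∈F v v∈e))
    go false false true  _   _   eq₂ = trans (cong (decode k (toℕ i) (toℕ j)) (γ-delete (P (fsuc (fsuc fzero))) e e∈F eq₂ v v∈e))
      (decode-pattern₂ k (toℕ i) (toℕ j) (rankIn rk e v) (rank<k e e∈F v v∈e))
    go false false false eq₀ eq₁ eq₂ with () ← trans (sym (cong₂ _∨_ eq₀ (cong₂ _∨_ eq₁ eq₂))) matched

  vanishing : ∀ E′ (dec : ℕ → ℕ) → (∀ e → E′ e ≡ true → EF e ≡ true) →
    (∀ e → E′ e ≡ true → ∀ v → lookup e v ≡ true → dec (γ (delete v e)) ≡ rankIn rk e v) →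
    Vanishing k rk E′
  vanishing E′ dec E′⊆F rank = (λ S → clamp k′ (dec (γ S))) , λ e e∈ v v∈e →
    let v∈ = []=⇒lookup v∈e
        eq = trans (cong (dec ∘ γ) (∖≡delete e v)) (rank e e∈ v v∈)
    in trans (cong (toℕ ∘ clamp k′) eq) (toℕ-clamp k′ (rankIn rk e v) (rank<k e (E′⊆F e e∈) v v∈))

  lType : ∀ E′ e g v → E′ e ≡ true → lookup (e ∩ g) v ≡ false → (e ∩ g) ∪ ⁅ v ⁆ ≡ e →
    LType rk E′ (e ∩ g) (rankIn rk e v)
  lType E′ e g v e∈ v∉ ∪≡ = v , v∉S , trans (cong E′ ∪≡) e∈ , cong (λ s → rankIn rk s v) ∪≡
    where
    v∉S : v ∉ˢ (e ∩ g)
    v∉S v∈S with () ← trans (sym v∉) ([]=⇒lookup v∈S)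

  -- The shared face has a single colour, which is its position in `e₁` and decodes to its position
  -- in `e₂`. Among the colours below `k`, `decode` moves only `i`, and it moves it to `j`.
  compatible : ∀ e₁ e₂ → E₁ e₁ ≡ true → E₂ e₂ ≡ true → ∣ e₁ ∩ e₂ ∣ ≡ k ∸ 1 →
    (Σ (Fin k) λ ℓ → (LType rk E₁ (e₁ ∩ e₂) (toℕ ℓ) × LType rk E₂ (e₁ ∩ e₂) (toℕ ℓ)))
    ⊎ (LType rk E₁ (e₁ ∩ e₂) (toℕ i) × LType rk E₂ (e₁ ∩ e₂) (toℕ j))
  compatible e₁ e₂ e₁∈ e₂∈ size
    with ∩-misses-one e₁ e₂ (trans (isKGraph e₁ (∧-trueˡ e₁∈)) (cong suc (sym size)))
       | ∩-misses-one e₂ e₁ (trans (isKGraph e₂ (∧-trueˡ e₂∈)) (cong suc (trans (sym size) (cong ∣_∣ (∩-comm e₁ e₂)))))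
  ... | v₁ , v₁∈ , v₁∉ , ∪≡₁ , del₁ | v₂ , v₂∈ , v₂∉ , ∪≡₂ , del₂ = types (ℓ₁ ≟ toℕ i)
    where
    ℓ₁ ℓ₂ : ℕ
    ℓ₁ = rankIn rk e₁ v₁
    ℓ₂ = rankIn rk e₂ v₂
    ℓ₁<k : ℓ₁ < k
    ℓ₁<k = rank<k e₁ (∧-trueˡ e₁∈) v₁ v₁∈
    ℓ₂≡ : decode k (toℕ i) (toℕ j) ℓ₁ ≡ ℓ₂
    ℓ₂≡ = trans (cong (decode k (toℕ i) (toℕ j)) (trans (sym (rank₁ e₁ e₁∈ v₁ v₁∈))
        (cong γ (trans del₁ (trans (∩-comm e₁ e₂) (sym del₂))))))
      (rank₂ e₂ e₂∈ v₂ v₂∈)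
    type₁ : LType rk E₁ (e₁ ∩ e₂) ℓ₁
    type₁ = lType E₁ e₁ e₂ v₁ e₁∈ v₁∉ ∪≡₁
    type₂ : LType rk E₂ (e₁ ∩ e₂) ℓ₂
    type₂ = subst (λ S → LType rk E₂ S ℓ₂) (∩-comm e₂ e₁) (lType E₂ e₂ e₁ v₂ e₂∈ v₂∉ ∪≡₂)
    types : Dec (ℓ₁ ≡ toℕ i) →
      (Σ (Fin k) λ ℓ → (LType rk E₁ (e₁ ∩ e₂) (toℕ ℓ) × LType rk E₂ (e₁ ∩ e₂) (toℕ ℓ)))
      ⊎ (LType rk E₁ (e₁ ∩ e₂) (toℕ i) × LType rk E₂ (e₁ ∩ e₂) (toℕ j))
    types (yes ℓ₁≡i) = inj₂ (subst (LType rk E₁ (e₁ ∩ e₂)) ℓ₁≡i type₁ ,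
      subst (LType rk E₂ (e₁ ∩ e₂)) (trans (sym ℓ₂≡) (trans (cong (decode k (toℕ i) (toℕ j)) ℓ₁≡i)
        (decode-i k (toℕ i) (toℕ j) (<⇒≢ (toℕ<n i))))) type₂)
    types (no ℓ₁≢i) = inj₁ (fromℕ< ℓ₁<k ,
      subst (LType rk E₁ (e₁ ∩ e₂)) (sym (toℕ-fromℕ< ℓ₁<k)) type₁ ,
      subst (LType rk E₂ (e₁ ∩ e₂)) (trans (sym ℓ₂≡) (trans
        (decode-other k (toℕ i) (toℕ j) ℓ₁ (<⇒≢ ℓ₁<k) ℓ₁≢i) (sym (toℕ-fromℕ< ℓ₁<k)))) type₂)

  spadeClause : SpadeClause k i j rk E₁ E₂
  spadeClause = rk-injective , vanishing E₁ id (λ _ → ∧-trueˡ) rank₁ ,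
    vanishing E₂ (decode k (toℕ i) (toℕ j)) (λ _ → ∧-trueˡ) rank₂ , compatible

-- Decidability of containment, and the search over pairs

anyVec? : ∀ {n} f {P : Vec (Fin n) f → Set} → (∀ xs → Dec (P xs)) → Dec (∃ P)
anyVec? zero    P? = map′ ([] ,_) (λ { ([] , p) → p }) (P? [])
anyVec? (suc f) P? = map′ (λ (x , xs , p) → x ∷ xs , p) (λ { (x ∷ xs , p) → x , xs , p })
  (any? (λ x → anyVec? f (λ xs → P? (x ∷ xs))))

IsEmbedding : ∀ {f n} → (Subset f → Bool) → (Subset n → Bool) → (Fin f → Fin n) → Set
IsEmbedding EF E φ = Injective _≡_ _≡_ φ × (∀ e → EF e ≡ true → E (image φ e) ≡ true)

isEmbedding? : ∀ {f n} (EF : Subset f → Bool) (E : Subset n → Bool) φ → Dec (IsEmbedding EF E φ)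
isEmbedding? {f} EF E φ =
  map′ (λ h {x} {y} → h x y) (λ inj x y → inj) (all? λ x → all? λ y → (φ x ≟ᶠ φ y) →-dec (x ≟ᶠ y))
  ×-dec
  map′ (λ h e e∈ → not-∨⁻ (allᵇ⁻ (allSubsets f) _ h (∈-allSubsets e)) e∈)
    (λ h → allᵇ⁺ (allSubsets f) _ (λ e → not-∨⁺ (h e)))
    (allᵇ (λ e → not (EF e) ∨ E (image φ e)) (allSubsets f) ≟ᵇ true)

isEmbedding-cong : ∀ {f n} (EF : Subset f → Bool) (E : Subset n → Bool) {φ ψ} → (∀ x → φ x ≡ ψ x) →
  IsEmbedding EF E φ → IsEmbedding EF E ψ
isEmbedding-cong EF E φ≗ψ (inj , embeds) =
  (λ {x} {y} eq → inj (trans (φ≗ψ x) (trans eq (sym (φ≗ψ y))))) ,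
  λ e e∈ → trans (cong E (sym (image-cong φ≗ψ e))) (embeds e e∈)

-- Maps are searched through their vectors of values; pointwise invariance of embeddings stands in
-- for function extensionality.
contains? : ∀ {f n} (EF : Subset f → Bool) (E : Subset n → Bool) → Dec (Contains EF E)
contains? {f} EF E = map′ (λ (xs , h) → lookup xs , h)
  (λ (φ , h) → tabulate φ , isEmbedding-cong EF E (λ x → sym (lookup∘tabulate φ x)) h)
  (anyVec? f (λ xs → isEmbedding? EF E (lookup xs)))

Fin-∀⊎ : ∀ n {P : Fin n → Set} {B : Set} → (∀ x → P x ⊎ B) → (∀ x → P x) ⊎ B
Fin-∀⊎ zero    h = inj₁ λ ()
Fin-∀⊎ (suc n) h with h fzero | Fin-∀⊎ n (h ∘ fsuc)
... | inj₂ b | _       = inj₂ b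
... | inj₁ _ | inj₂ b  = inj₂ b
... | inj₁ p | inj₁ ps = inj₁ λ { fzero → p ; (fsuc x) → ps x }

-- Whether F embeds into the graph built for the pair (i , j) is decidable, so no pair at
-- which (♠*) fails has to be known in advance.
clause-or-free : ∀ k′ {f n} (EF : Subset f → Bool) → IsKGraph (suc k′) EF →
  (i j : Fin (suc k′)) (c : Subset n → Fin (suc (suc k′))) →
  (Σ (Subset f → Bool) λ σ → Σ (Fin f → Fin f) λ rk →
    SpadeClause (suc k′) i j rk (part₁ EF σ) (part₂ EF σ)) ⊎
  FFree EF (graph (suc k′) (toℕ i) (toℕ j) c)
clause-or-free k′ EF isKGraph i j c = decide (contains? EF (graph (suc k′) (toℕ i) (toℕ j) c))
  where
  decide : Dec (Contains EF (graph (suc k′) (toℕ i) (toℕ j) c)) → _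
  decide (no free)                  = inj₂ free
  decide (yes (φ , inj , embeds)) = inj₁ (σ , InducedOrder.rk φ inj , spadeClause)
    where open Embedding k′ EF isKGraph i j c φ inj embeds

theorem7p1 : (k : ℕ) → 3 ≤ k → (f : ℕ) (EF : Subset f → Bool) →
    IsKGraph k EF → ¬ Spade k EF →
    PiAtLeast k (k ∸ 2) EF (threeOver k) × invPow k ℚ.< threeOver k
theorem7p1 (suc (suc (suc k″))) (s≤s (s≤s (s≤s _))) f EF isKGraph ¬spade = admissible , invPow<threeOver (suc (suc k″))
  where
  k = suc (suc (suc k″))
  admissible : PiAtLeast k (k ∸ 2) EF (threeOver k)
  -- The pair whose graph turns out `F`-free may vary with `d`, `μ` and `n₀`; admissibility asks for
  -- no uniform choice.
  admissible d _ d< μ μ>0 n₀ = conclude (Fin-∀⊎ k (λ i → Fin-∀⊎ k (λ j → attempt i j (toℕ i <? toℕ j))))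
    where
    Clause : Fin k → Fin k → Set
    Clause i j = Σ (Subset f → Bool) λ σ → Σ (Fin f → Fin f) λ rk →
      SpadeClause k i j rk (part₁ EF σ) (part₂ EF σ)
    Goal : Set
    Goal = ∃ λ n → n₀ ≤ n × Σ (Subset n → Bool) λ E → (IsKGraph k {n} E × FFree EF E × Dense k E d μ (k ∸ 2))
    conclude : (∀ i j → toℕ i < toℕ j → Clause i j) ⊎ Goal → Goal
    conclude (inj₁ spade) = ⊥-elim (¬spade spade)
    conclude (inj₂ goal)  = goal
    finish : ∀ i j → (∃ λ n → n₀ ≤ n × Σ (Subset n → Fin (suc k)) λ c → Dense k (graph k (toℕ i) (toℕ j) c) d μ (suc k″)) →
      (toℕ i < toℕ j → Clause i j) ⊎ Goal
    finish i j (n , n₀≤n , c , dense) = Sum.map const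
      (λ free → n , n₀≤n , graph k (toℕ i) (toℕ j) c , graph-isKGraph k (toℕ i) (toℕ j) c , free , dense)
      (clause-or-free (suc (suc k″)) EF isKGraph i j c)
    attempt : ∀ i j → Dec (toℕ i < toℕ j) → (toℕ i < toℕ j → Clause i j) ⊎ Goal
    attempt i j (no  i≮j) = inj₁ (⊥-elim ∘ i≮j)
    attempt i j (yes i<j) = finish i j
      (∃-dense (suc k″) (toℕ i) (toℕ j) (toℕ<n i) (toℕ<n j) (<⇒≢ i<j) d d< μ μ>0 n₀)
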